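{- For all $k\geq 3$, $AR_{FF}(C_k) = \frac{k^2}{8}(1+o(1))$, where $C_k$ is the cycle with $k$ edges and $o(1)$ is a function of $k$ tending to $0$ as $k\to\infty$.
   Context: All graphs are finite and simple. An edge-colored graph is rainbow if all its edges have distinct colors. A copy of $H$ is a (not necessarily induced) subgraph isomorphic to $H$. $AR_{FF}(H)$ (First-Fit anti-Ramsey number): Builder presents vertices and edges of a simple graph, one edge at a time, and each new edge is immediately colored by Painter with the smallest color in $\{1,2,\ldots\}$ not used on an adjacent edge already presented (First-Fit). $AR_{FF}(H)$ is the smallest $t$ such that Builder can present $t$ edges so that the resulting colored graph contains a rainbow copy of $H$. -}

module Defs where

open import Data.Empty using (⊥)
open import Data.Fin.Base using (Fin; toℕ)
open import Data.List.Base using (List; []; _∷_; length)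
open import Data.List.Relation.Unary.Any using (Any)
open import Data.Nat.Base using (ℕ; suc; _≤_; s≤s)
import Data.Nat.Properties as ℕ
open import Data.Product.Base using (_×_; _,_; ∃; ∃-syntax)
open import Data.Rational.Base using (ℚ; 0ℚ; ∣_∣; _<_)
open import Data.Sum.Base using (_⊎_; inj₁; inj₂; swap)
open import Function.Bundles using (_↣_; module Injection)
open import Relation.Binary.Core using (Rel)
open import Relation.Binary.Definitions using (Decidable; Irreflexive; Symmetric)
open import Relation.Binary.PropositionalEquality using (_≡_; _≢_; refl; sym; trans; cong)
open import Relation.Nullary using (¬_)
open import Relation.Nullary.Decidable using (_×-dec_; _⊎-dec_)
open import Level using (0ℓ)

IsLeast : (ℕ → Set) → ℕ → Set
IsLeast P m = P m × (∀ i → P i → m ≤ i)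

TendsToZero : (ℕ → ℚ) → Set
TendsToZero f = ∀ (ε : ℚ) → 0ℚ < ε → ∃[ N ] (∀ n → N ≤ n → ∣ f n ∣ < ε)

record SimpleGraph : Set₁ where
  field
    order      : ℕ
    Adj        : Rel (Fin order) 0ℓ
    adj?       : Decidable Adj
    sym-Adj    : Symmetric Adj
    irrefl-Adj : Irreflexive _≡_ Adj

module _ {k : ℕ} where

  -- j is the successor of i modulo k
  Next : Rel (Fin k) 0ℓ
  Next i j = toℕ j ≡ suc (toℕ i) ⊎ (suc (toℕ i) ≡ k × toℕ j ≡ 0)

  next? : Decidable Next
  next? i j = (toℕ j ℕ.≟ suc (toℕ i)) ⊎-dec ((suc (toℕ i) ℕ.≟ k) ×-dec (toℕ j ℕ.≟ 0))

  next-irrefl : 3 ≤ k → ∀ {i} → ¬ Next i i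
  next-irrefl _   (inj₁ i≡1+i)         = ℕ.1+n≢n (sym i≡1+i)
  next-irrefl 3≤k (inj₂ (1+i≡k , i≡0)) = absurd 3≤k (trans (sym 1+i≡k) (cong suc i≡0))
    where
    absurd : ∀ {m} → 3 ≤ m → m ≡ 1 → ⊥
    absurd (s≤s ()) refl

cycle : ∀ k → 3 ≤ k → SimpleGraph
cycle k 3≤k = record
  { order      = k
  ; Adj        = λ i j → Next i j ⊎ Next j i
  ; adj?       = λ i j → next? i j ⊎-dec next? j i
  ; sym-Adj    = swap
  ; irrefl-Adj = λ { refl (inj₁ p) → next-irrefl 3≤k p
                   ; refl (inj₂ p) → next-irrefl 3≤k p }
  }

-- The edge is unordered: `fst` and `snd` only name its two endpoints.
record ColoredEdge (n : ℕ) : Set where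
  constructor edge
  field
    fst snd : Fin n
    color   : ℕ

open ColoredEdge

-- The most recently presented edge comes first.
ColoredGraph : ℕ → Set
ColoredGraph n = List (ColoredEdge n)

module _ {n : ℕ} where

  Joins : ColoredEdge n → Rel (Fin n) 0ℓ
  Joins e u v = (fst e ≡ u × snd e ≡ v) ⊎ (fst e ≡ v × snd e ≡ u)

  EndsAt : ColoredEdge n → Fin n → Set
  EndsAt e u = fst e ≡ u ⊎ snd e ≡ u

  HasEdge : ColoredGraph n → Rel (Fin n) 0ℓ
  HasEdge G u v = Any (λ e → Joins e u v) G

  HasColoredEdge : ColoredGraph n → Fin n → Fin n → ℕ → Set
  HasColoredEdge G u v c = Any (λ e → Joins e u v × color e ≡ c) G

  UsedNear : ColoredGraph n → Fin n → Fin n → ℕ → Set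
  UsedNear G u v c = Any (λ e → (EndsAt e u ⊎ EndsAt e v) × color e ≡ c) G

  FirstFitColor : ColoredGraph n → Fin n → Fin n → ℕ → Set
  FirstFitColor G u v = IsLeast (λ c → 1 ≤ c × ¬ UsedNear G u v c)

  -- The colored graphs that can arise when Builder presents the edges of a
  -- simple graph one at a time and Painter answers with First-Fit.
  data FirstFit : ColoredGraph n → Set where
    []      : FirstFit []
    present : ∀ {G u v c} → FirstFit G → u ≢ v → ¬ HasEdge G u v →
              FirstFitColor G u v c → FirstFit (edge u v c ∷ G)

module _ (H : SimpleGraph) where
  open SimpleGraph H

  -- Two edges xy and zw of H whose copies share a color are the same edge.
  record RainbowCopy {n : ℕ} (G : ColoredGraph n) : Set where
    field
      embedding : Fin order ↣ Fin n
    open Injection embedding public using () renaming (to to φ)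
    field
      preserves : ∀ {x y} → Adj x y → HasEdge G (φ x) (φ y)
      rainbow   : ∀ {x y z w c} → Adj x y → Adj z w →
                  HasColoredEdge G (φ x) (φ y) c → HasColoredEdge G (φ z) (φ w) c →
                  (x ≡ z × y ≡ w) ⊎ (x ≡ w × y ≡ z)

  -- Presenting vertices is free, so Builder may as well present all n of them
  -- up front, with n arbitrary.
  BuilderForces : ℕ → Set
  BuilderForces t =
    ∃[ n ] ∃ λ (G : ColoredGraph n) → length G ≡ t × FirstFit G × RainbowCopy G

  IsAR-FF : ℕ → Set
  IsAR-FF = IsLeast BuilderForces

{-# OPTIONS --safe #-}
-- Lower bound.  An edge of color c meets edges of all smaller colors.  The k cycle edges have
-- distinct colors, so together they meet at least 0 + 1 + … + (k - 1) presented edges, counted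
-- with multiplicity; a presented edge meets at most four cycle edges.  Hence t ≥ k(k - 1)/8.
--
-- Upper bound.  Almost every extra edge should have both ends on the cycle and serve four cycle
-- edges.  Number the cycle vertices consecutively and call the odd ones hubs.  Give the value
-- χ = r + 2 to the cycle edge {r, r + 1} and the value r + t + 2 to a chord from a hub r to any
-- t ≥ r + 2, and let colors decrease as values increase.  Chords at hub r realise all values from
-- 2r + 4 on, and pendant edges supply the values 2r - 1, 2r + 1, 2r + 2, 2r + 3 near the missing
-- chord {r, r}; so a hub sees all values needed by its own chords.  A cycle edge at hub r also
-- needs the values between r and 2r: chords from smaller hubs bring the even ones to r and the
-- odd ones to its even end.  Since r + t determines χ, this is a proper coloring of a simple
-- graph with k²/8 + O(k) edges.
--
-- The least t exists constructively because only vertices of presented edges matter, which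
-- makes it decidable whether t edges suffice.
module Submission where

open import Defs
import Algebra.Properties.CommutativeMonoid.Sum as CommutativeMonoidSum
open import Data.Bool.Base using (true; false; if_then_else_)
open import Data.Empty using (⊥-elim)
open import Data.Fin.Base using (Fin; zero; suc; toℕ; fromℕ<; punchIn)
import Data.Fin.Properties as Fin
import Data.Integer.Base as ℤ
import Data.Integer.Properties as ℤ
import Data.Integer.Tactic.RingSolver as ℤ-Solver
open import Data.List.Base using (List; []; _∷_; _++_; length; map; lookup; filter; upTo)
open import Data.List.Properties using (length-map; length-++; length-upTo)
open import Data.List.Membership.DecPropositional using (_∈?_)
open import Data.List.Membership.Propositional using (_∈_; find)
open import Data.List.Membership.Propositional.Properties
  using (∈-filter⁺; ∈-map⁺; ∈-map⁻; ∈-upTo⁺; ∈-upTo⁻)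
open import Data.List.Relation.Unary.All as All using (All; []; _∷_)
import Data.List.Relation.Unary.All.Properties as All
open import Data.List.Relation.Unary.AllPairs using (AllPairs; []; _∷_)
import Data.List.Relation.Unary.AllPairs.Properties as AllPairs
open import Data.List.Relation.Unary.Any as Any using (Any; here; there)
import Data.List.Relation.Unary.Any.Properties as Any
open import Data.Nat.Base using (ℕ; zero; suc; _≤_; _^_; z≤n; s≤s; s≤s⁻¹)
import Data.Nat.Base as ℕ
open import Data.Nat.Induction using (<-rec)
open import Data.Nat.ListAction using (sum)
import Data.Nat.Properties as ℕ
open import Data.Nat.Tactic.RingSolver using (solve-∀)
open import Data.Product.Base using (Σ; _×_; _,_; ∃; ∃₂; proj₁; proj₂; map₁; map₂)
import Data.Product.Properties as ×
import Data.Rational.Properties as ℚ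
open import Data.Rational.Unnormalised.Base as ℚᵘ using (mkℚᵘ; 1ℚᵘ; *≡*; *<*)
import Data.Rational.Unnormalised.Properties as ℚᵘ
open import Data.Sum.Base as Sum using (_⊎_; inj₁; inj₂; swap)
import Data.Sum.Properties as ⊎
open import Data.Vec.Base as Vec using (Vec; []; _∷_)
import Data.Vec.Properties as Vec
open import Function.Base using (_∘_; id; case_of_)
open import Function.Bundles using (mk↣; module Injection)
open import Function.Definitions using (Injective)
open import Relation.Binary.Definitions using (DecidableEquality)
open import Relation.Binary.PropositionalEquality
  using (_≡_; _≢_; refl; sym; trans; cong; cong₂; subst; subst₂; module ≡-Reasoning)
open import Relation.Nullary using (¬_; Dec; yes; no; contradiction; does)
open import Relation.Nullary.Decidable
  using (_×-dec_; _⊎-dec_; _→-dec_; ¬?; map′; decidable-stable)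
import Relation.Unary as U

private
  module Sumℕ = CommutativeMonoidSum ℕ.+-0-commutativeMonoid

module _ where
  open import Data.Nat.Base using (_+_; _*_; _∸_; _<_)

  -- Least witnesses of decidable predicates.

  least : ∀ {P : ℕ → Set} → U.Decidable P → ∀ m → P m → ∃ (IsLeast P)
  least {P} P? = <-rec _ λ m rec Pm → case ℕ.anyUpTo? P? m of λ where
    (yes (i , i<m , Pi)) → rec i<m Pi
    (no none)            → m , Pm , λ i Pi → ℕ.≮⇒≥ λ i<m → none (i , i<m , Pi)

  least-unique : ∀ {P : ℕ → Set} {m n} → IsLeast P m → IsLeast P n → m ≡ n
  least-unique (Pm , m≤) (Pn , n≤) = ℕ.≤-antisym (m≤ _ Pn) (n≤ _ Pm)

  -- Local form of First-Fit

  module _ {A : Set} where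

    SamePair : A × A → A × A → Set
    SamePair (x , y) (u , v) = (x ≡ u × y ≡ v) ⊎ (x ≡ v × y ≡ u)

    Meets : A × A → A × A → Set
    Meets (x , y) (u , v) = (x ≡ u ⊎ y ≡ u) ⊎ (x ≡ v ⊎ y ≡ v)

    SamePair⇒Meets : ∀ {e f} → SamePair e f → Meets e f
    SamePair⇒Meets (inj₁ (x≡u , _)) = inj₁ (inj₁ x≡u)
    SamePair⇒Meets (inj₂ (x≡v , _)) = inj₂ (inj₁ x≡v)

    SamePair-euclidean : ∀ {e f g} → SamePair e f → SamePair e g → SamePair f g
    SamePair-euclidean (inj₁ (refl , refl)) q = q
    SamePair-euclidean (inj₂ (refl , refl)) (inj₁ (refl , refl)) = inj₂ (refl , refl)
    SamePair-euclidean (inj₂ (refl , refl)) (inj₂ (refl , refl)) = inj₁ (refl , refl)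

    -- First-Fit histories over an arbitrary vertex type, with the least-color
    -- condition unfolded into its two halves.
    data Greedy : List ((A × A) × ℕ) → Set where
      []      : Greedy []
      present : ∀ {G e c} → Greedy G → proj₁ e ≢ proj₂ e →
                All (λ f → ¬ SamePair (proj₁ f) e) G →
                1 ≤ c →
                All (λ f → Meets (proj₁ f) e → proj₂ f ≢ c) G →
                (∀ {j} → 1 ≤ j → j < c → Any (λ f → Meets (proj₁ f) e × proj₂ f ≡ j) G) →
                Greedy ((e , c) ∷ G)

    SamePair-sym : ∀ {e f} → SamePair e f → SamePair f e
    SamePair-sym p = SamePair-euclidean p (inj₁ (refl , refl))

    clash : ∀ {G : List ((A × A) × ℕ)} {e f c} → All (λ g → ¬ SamePair (proj₁ g) e) G →
            SamePair e f → ¬ Any (λ g → SamePair (proj₁ g) f × proj₂ g ≡ c) G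
    clash new p = All.All¬⇒¬Any new ∘
      Any.map λ (q , _) → SamePair-euclidean (SamePair-sym q) (SamePair-sym p)

    -- No edge is presented twice, so only one entry of the history can carry its color.
    color-unique : ∀ {G e c d} → Greedy G →
                   Any (λ f → SamePair (proj₁ f) e × proj₂ f ≡ c) G →
                   Any (λ f → SamePair (proj₁ f) e × proj₂ f ≡ d) G → c ≡ d
    color-unique (present _ _ _ _ _ _) (here (_ , refl)) (here (_ , refl)) = refl
    color-unique (present g _ _ _ _ _) (there p) (there q) = color-unique g p q
    color-unique (present _ _ new _ _ _) (here (p , _)) (there q) = ⊥-elim (clash new p q)
    color-unique (present _ _ new _ _ _) (there p) (here (q , _)) = ⊥-elim (clash new q p)

    Meets-respʳ : ∀ {e f g} → SamePair f g → Meets e f → Meets e g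
    Meets-respʳ (inj₁ (refl , refl)) = id
    Meets-respʳ (inj₂ (refl , refl)) = swap

    1≤color : ∀ {G e c} → Greedy G → Any (λ f → SamePair (proj₁ f) e × proj₂ f ≡ c) G → 1 ≤ c
    1≤color (present _ _ _ 1≤c _ _) (here (_ , refl)) = 1≤c
    1≤color (present g _ _ _ _ _)   (there p)         = 1≤color g p

    -- The smaller colors were seen when the edge was presented, and no edge is ever removed.
    smaller-color-met : ∀ {G e c} → Greedy G → Any (λ f → SamePair (proj₁ f) e × proj₂ f ≡ c) G →
                        ∀ {j} → 1 ≤ j → j < c → Any (λ f → Meets (proj₁ f) e × proj₂ f ≡ j) G
    smaller-color-met (present _ _ _ _ _ below) (here (p , refl)) 1≤j j<c =
      there (Any.map (map₁ (Meets-respʳ p)) (below 1≤j j<c))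
    smaller-color-met (present g _ _ _ _ _) (there p) 1≤j j<c =
      there (smaller-color-met g p 1≤j j<c)

    Ends : (A → Set) → (A × A) × ℕ → Set
    Ends P ((u , v) , _) = P u × P v

    endpoints : List ((A × A) × ℕ) → List A
    endpoints []                  = []
    endpoints (((u , v) , _) ∷ G) = u ∷ v ∷ endpoints G

    length-endpoints : ∀ G → length (endpoints G) ≡ 2 * length G
    length-endpoints []      = refl
    length-endpoints (_ ∷ G) = trans (cong (2 +_) (length-endpoints G)) (sym (ℕ.*-suc 2 (length G)))

    ends∈endpoints : ∀ G → All (Ends (_∈ endpoints G)) G
    ends∈endpoints []                  = []
    ends∈endpoints (_ ∷ G) = (here refl , there (here refl)) ∷
      All.map (λ (p , q) → there (there p) , there (there q)) (ends∈endpoints G)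

    SamePair⇒∈endpoints : ∀ {G x y} → Any (λ f → SamePair (proj₁ f) (x , y)) G → x ∈ endpoints G
    SamePair⇒∈endpoints (here (inj₁ (refl , _))) = here refl
    SamePair⇒∈endpoints (here (inj₂ (_ , refl))) = there (here refl)
    SamePair⇒∈endpoints (there p)                = there (there (SamePair⇒∈endpoints p))

    module _ (_≟_ : DecidableEquality A) (xs : List A) where

      -- Elements outside xs are sent to zero.
      position : A → Fin (suc (length xs))
      position x with _∈?_ _≟_ x xs
      ... | yes x∈xs = suc (Any.index x∈xs)
      ... | no  _    = zero

      position-injective : ∀ {x y} → x ∈ xs → y ∈ xs → position x ≡ position y → x ≡ y
      position-injective {x} {y} x∈xs y∈xs eq with _∈?_ _≟_ x xs | _∈?_ _≟_ y xs
      ... | no x∉xs | _       = contradiction x∈xs x∉xs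
      ... | yes _   | no y∉xs = contradiction y∈xs y∉xs
      ... | yes p   | yes q   = trans (Any.lookup-index p)
        (trans (cong (lookup xs) (Fin.suc-injective eq)) (sym (Any.lookup-index q)))

  -- Renaming vertices.

  relabel : {A B : Set} → (A → B) → (A × A) × ℕ → (B × B) × ℕ
  relabel f ((u , v) , c) = (f u , f v) , c

  module _ {A B : Set} (f : A → B) {P : A → Set}
           (f-inj : ∀ {x y} → P x → P y → f x ≡ f y → x ≡ y) where

    SamePair-reflect : ∀ {x y u v} → P x → P y → P u → P v →
                       SamePair (f x , f y) (f u , f v) → SamePair (x , y) (u , v)
    SamePair-reflect px py pu pv =
      Sum.map (λ (p , q) → f-inj px pu p , f-inj py pv q)
              (λ (p , q) → f-inj px pv p , f-inj py pu q)

    Meets-reflect : ∀ {x y u v} → P x → P y → P u → P v →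
                    Meets (f x , f y) (f u , f v) → Meets (x , y) (u , v)
    Meets-reflect px py pu pv =
      Sum.map (Sum.map (f-inj px pu) (f-inj py pu)) (Sum.map (f-inj px pv) (f-inj py pv))

    -- Looplessness, novelty and freeness of the color are negative conditions, so they need `f` to
    -- be injective on the vertices that occur; the condition on smaller colors survives any map.
    Greedy-relabel : ∀ {G} → All (Ends P) G → Greedy G → Greedy (map (relabel f) G)
    Greedy-relabel [] [] = []
    Greedy-relabel ((pu , pv) ∷ ps) (present g u≢v new 1≤c free below) =
      present (Greedy-relabel ps g) (u≢v ∘ f-inj pu pv)
        (All.map⁺ (All.zipWith (λ ((px , py) , ≁) → ≁ ∘ SamePair-reflect px py pu pv) (ps , new)))
        1≤c
        (All.map⁺ (All.zipWith (λ ((px , py) , ≁) → ≁ ∘ Meets-reflect px py pu pv) (ps , free)))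
        (λ 1≤j j<c → Any.map⁺ (Any.map (map₁ Meets-map) (below 1≤j j<c)))
      where
      Meets-map : ∀ {x y u v} → Meets (x , y) (u , v) → Meets (f x , f y) (f u , f v)
      Meets-map = Sum.map (Sum.map (cong f) (cong f)) (Sum.map (cong f) (cong f))

  -- First-Fit histories as greedy histories on finitely many vertices.

  module _ {n : ℕ} where

    bare : ColoredEdge n → (Fin n × Fin n) × ℕ
    bare (edge u v c) = (u , v) , c

    dress : (Fin n × Fin n) × ℕ → ColoredEdge n
    dress ((u , v) , c) = edge u v c

    joins? : ∀ u v → U.Decidable (λ e → Joins {n} e u v)
    joins? u v (edge x y _) = (x Fin.≟ u ×-dec y Fin.≟ v) ⊎-dec (x Fin.≟ v ×-dec y Fin.≟ u)

    meets? : ∀ e → U.Decidable (λ (f : (Fin n × Fin n) × ℕ) → Meets (proj₁ f) e)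
    meets? (u , v) ((x , y) , _) = (x Fin.≟ u ⊎-dec y Fin.≟ u) ⊎-dec (x Fin.≟ v ⊎-dec y Fin.≟ v)

    usedNear? : ∀ G u v → U.Decidable (UsedNear {n} G u v)
    usedNear? G u v c = Any.any? (λ e → meets? (u , v) (bare e) ×-dec ColoredEdge.color e ℕ.≟ c) G

    hasEdge? : ∀ G u v → Dec (HasEdge {n} G u v)
    hasEdge? G u v = Any.any? (joins? u v) G

    hasColoredEdge? : ∀ G u v → U.Decidable (HasColoredEdge {n} G u v)
    hasColoredEdge? G u v c = Any.any? (λ e → joins? u v e ×-dec ColoredEdge.color e ℕ.≟ c) G

    Greedy⇒FirstFit : ∀ {G} → Greedy G → FirstFit (map dress G)
    Greedy⇒FirstFit [] = []
    Greedy⇒FirstFit (present g u≢v new 1≤c free below) =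
      present (Greedy⇒FirstFit g) u≢v
        (All.All¬⇒¬Any new ∘ Any.map⁻)
        ( (1≤c , λ used → All.All¬⇒¬Any (All.map (λ h (m , eq) → h m eq) free) (Any.map⁻ used))
        , λ i (1≤i , unused) → ℕ.≮⇒≥ λ i<c → unused (Any.map⁺ (below 1≤i i<c)))

    FirstFit⇒Greedy : ∀ {G} → FirstFit G → Greedy (map bare G)
    FirstFit⇒Greedy [] = []
    FirstFit⇒Greedy (present {G} {u} {v} ff u≢v new ((1≤c , unused) , c≤)) =
      present (FirstFit⇒Greedy ff) u≢v
        (All.map⁺ (All.¬Any⇒All¬ G new)) 1≤c
        (All.map⁺ (All.map (λ h m eq → h (m , eq)) (All.¬Any⇒All¬ G unused)))
        (λ {j} 1≤j j<c → Any.map⁺ (decidable-stable (usedNear? G u v j)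
          λ j-unused → ℕ.<⇒≱ j<c (c≤ j (1≤j , j-unused))))

    HasColoredEdge-unique : ∀ {G u v c d} → FirstFit {n} G →
      HasColoredEdge G u v c → HasColoredEdge G u v d → c ≡ d
    HasColoredEdge-unique ff p q = color-unique (FirstFit⇒Greedy ff) (Any.map⁺ p) (Any.map⁺ q)

    HasEdge⇒HasColoredEdge : ∀ {G u v} → HasEdge {n} G u v → ∃ (HasColoredEdge G u v)
    HasEdge⇒HasColoredEdge (here p)  = _ , here (p , refl)
    HasEdge⇒HasColoredEdge (there p) = map₂ there (HasEdge⇒HasColoredEdge p)

    HasColoredEdge⇒HasEdge : ∀ {G u v c} → HasColoredEdge {n} G u v c → HasEdge G u v
    HasColoredEdge⇒HasEdge = Any.map proj₁

    -- Decidability of Builder's success with a given number of edges.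

    totalColor : ColoredGraph n → ℕ
    totalColor = sum ∘ map ColoredEdge.color

    color≤total : ∀ {G : ColoredGraph n} {P : ColoredEdge n → Set} {c} →
                  Any (λ e → P e × ColoredEdge.color e ≡ c) G → c ≤ totalColor G
    color≤total {_ ∷ G} (here (_ , refl)) = ℕ.m≤m+n _ (totalColor G)
    color≤total {e ∷ _} (there p)         = ℕ.m≤n⇒m≤o+n (ColoredEdge.color e) (color≤total p)

    -- One more than the sum of all colors is certainly free, which gives the search for the least
    -- free color a starting point.
    firstFitColor : ∀ G u v → ∃ (FirstFitColor {n} G u v)
    firstFitColor G u v = least (λ c → 1 ℕ.≤? c ×-dec ¬? (usedNear? G u v c)) (suc (totalColor G))
      (s≤s z≤n , λ used → ℕ.1+n≰n (color≤total used))

    -- The induction on `t` varies `Q`: asking for one more edge amounts to asking for a shorter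
    -- history that some last edge extends to one satisfying `Q`.
    FirstFit-search : (Q : ColoredGraph n → Set) → U.Decidable Q →
                      ∀ t → Dec (∃ λ G → length G ≡ t × FirstFit G × Q G)
    FirstFit-search Q Q? zero = map′ (λ q → [] , refl , [] , q) (λ { ([] , _ , _ , q) → q }) (Q? [])
    FirstFit-search Q Q? (suc t) =
      map′ (λ { (G , refl , ff , u , v , u≢v , new , c , ffc , q) →
                edge u v c ∷ G , refl , present ff u≢v new ffc , q })
           (λ { (edge u v c ∷ G , refl , present ff u≢v new ffc , q) →
                G , refl , ff , u , v , u≢v , new , c , ffc , q })
           (FirstFit-search _ extension? t)
      where
      Extension : ColoredGraph n → Set
      Extension G = ∃₂ λ u v → u ≢ v × ¬ HasEdge G u v ×
                    ∃ λ c → FirstFitColor G u v c × Q (edge u v c ∷ G)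

      colored? : ∀ G u v → Dec (∃ λ c → FirstFitColor G u v c × Q (edge u v c ∷ G))
      -- The First-Fit color is unique, so a single color has to be tested.
      colored? G u v with firstFitColor G u v
      ... | c , ffc = map′ (λ q → c , ffc , q)
        (λ (d , ffd , q) → subst (λ d → Q (edge u v d ∷ G)) (least-unique ffd ffc) q)
        (Q? (edge u v c ∷ G))

      extension? : U.Decidable Extension
      extension? G = Fin.any? λ u → Fin.any? λ v →
        ¬? (u Fin.≟ v) ×-dec ¬? (hasEdge? G u v) ×-dec colored? G u v

  -- Embeddings are searched for as vectors, which can be enumerated up to equality; functions could
  -- be enumerated only up to pointwise equality.
  Vec-search : ∀ {n} k (P : Vec (Fin n) k → Set) → U.Decidable P → Dec (∃ P)
  Vec-search zero    P P? = map′ ([] ,_) (λ { ([] , p) → p }) (P? [])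
  Vec-search (suc k) P P? = map′ (λ (x , xs , p) → x ∷ xs , p) (λ { (x ∷ xs , p) → x , xs , p })
    (Fin.any? λ x → Vec-search k (P ∘ (x ∷_)) (P? ∘ (x ∷_)))

  module _ (H : SimpleGraph) where
    open SimpleGraph H

    module _ {n : ℕ} (G : ColoredGraph n) where

      -- A decidable form of `RainbowCopy`: colors are quantified below a bound that every occurring
      -- color respects.
      IsRainbowCopy : (Fin order → Fin n) → Set
      IsRainbowCopy φ =
        (∀ x y → φ x ≡ φ y → x ≡ y) ×
        (∀ x y → Adj x y → HasEdge G (φ x) (φ y)) ×
        (∀ x y z w → Adj x y → Adj z w → ∀ {c} → c < suc (totalColor G) →
           HasColoredEdge G (φ x) (φ y) c → HasColoredEdge G (φ z) (φ w) c →
           (x ≡ z × y ≡ w) ⊎ (x ≡ w × y ≡ z))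

      isRainbowCopy? : U.Decidable IsRainbowCopy
      isRainbowCopy? φ =
        (Fin.all? λ x → Fin.all? λ y → φ x Fin.≟ φ y →-dec x Fin.≟ y) ×-dec
        (Fin.all? λ x → Fin.all? λ y → adj? x y →-dec hasEdge? G (φ x) (φ y)) ×-dec
        (Fin.all? λ x → Fin.all? λ y → Fin.all? λ z → Fin.all? λ w →
           adj? x y →-dec adj? z w →-dec
           ℕ.allUpTo? (λ c → hasColoredEdge? G (φ x) (φ y) c →-dec
                             hasColoredEdge? G (φ z) (φ w) c →-dec
                             ((x Fin.≟ z ×-dec y Fin.≟ w) ⊎-dec (x Fin.≟ w ×-dec y Fin.≟ z)))
                      (suc (totalColor G)))

      IsRainbowCopy⇒RainbowCopy : ∀ {φ} → IsRainbowCopy φ → RainbowCopy H G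
      IsRainbowCopy⇒RainbowCopy (inj , pres , rain) = record
        { embedding = mk↣ (λ {x} {y} → inj x y)
        ; preserves = pres _ _
        ; rainbow   = λ xy zw p q → rain _ _ _ _ xy zw (s≤s (color≤total p)) p q
        }

      IsRainbowCopy-resp : ∀ {φ ψ} → (∀ x → φ x ≡ ψ x) → IsRainbowCopy φ → IsRainbowCopy ψ
      IsRainbowCopy-resp {φ} {ψ} eq (inj , pres , rain) =
        (λ x y p → inj x y (trans (eq x) (trans p (sym (eq y))))) ,
        (λ x y xy → subst₂ (HasEdge G) (eq x) (eq y) (pres x y xy)) ,
        (λ x y z w xy zw {c} c< p q → rain x y z w xy zw c<
           (subst₂ (λ u v → HasColoredEdge G u v c) (sym (eq x)) (sym (eq y)) p)
           (subst₂ (λ u v → HasColoredEdge G u v c) (sym (eq z)) (sym (eq w)) q))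

      rainbowCopy? : Dec (RainbowCopy H G)
      rainbowCopy? = map′ (λ (_ , r) → IsRainbowCopy⇒RainbowCopy r) lookup-copy
        (Vec-search order (IsRainbowCopy ∘ Vec.lookup) (isRainbowCopy? ∘ Vec.lookup))
        where
        lookup-copy : RainbowCopy H G → ∃ (IsRainbowCopy ∘ Vec.lookup)
        lookup-copy r = Vec.tabulate φ , IsRainbowCopy-resp (λ x → sym (Vec.lookup∘tabulate φ x))
          ( (λ _ _ → Injection.injective (RainbowCopy.embedding r))
          , (λ _ _ → RainbowCopy.preserves r)
          , (λ _ _ _ _ xy zw _ → RainbowCopy.rainbow r xy zw))
          where open RainbowCopy r using (φ)

    module _ (no-isolated : ∀ x → ∃ (Adj x)) where

      -- As `H` has no isolated vertex, the copy lies among the `2 * t` listed endpoints, and these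
      -- can be renamed by their positions. The additional vertex is the default value of
      -- `position`.
      shrink : ∀ {t} → BuilderForces H t →
               ∃ λ (G : ColoredGraph (suc (2 * t))) → length G ≡ t × FirstFit G × RainbowCopy H G
      shrink (n , G , refl , ff , r) =
        subst (λ N → ∃ λ (G′ : ColoredGraph (suc N)) → length G′ ≡ length G × FirstFit G′ × RainbowCopy H G′)
          (trans (length-endpoints (map bare G)) (cong (2 *_) (length-map bare G)))
          (G′ , length-G′ , ff′ , r′)
        where
        open RainbowCopy r
        vs = endpoints (map bare G)
        f = position Fin._≟_ vs
        f-inj = position-injective Fin._≟_ vs
        G′ = map dress (map (relabel f) (map bare G))

        length-G′ : length G′ ≡ length G
        length-G′ = trans (length-map dress (map (relabel f) (map bare G)))
          (trans (length-map (relabel f) (map bare G)) (length-map bare G))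

        ff′ : FirstFit G′
        ff′ = Greedy⇒FirstFit (Greedy-relabel f f-inj (ends∈endpoints _) (FirstFit⇒Greedy ff))

        φ∈vs : ∀ x → φ x ∈ vs
        φ∈vs x = SamePair⇒∈endpoints (Any.map⁺ (preserves (proj₂ (no-isolated x))))

        transport : ∀ {u v c} → HasColoredEdge G u v c → HasColoredEdge G′ (f u) (f v) c
        transport = Any.map⁺ ∘ Any.map⁺ ∘ Any.map⁺ ∘
          Any.map (map₁ (Sum.map (λ (p , q) → cong f p , cong f q) (λ (p , q) → cong f p , cong f q)))

        reflect : ∀ {x y c} → Adj x y → HasColoredEdge G′ (f (φ x)) (f (φ y)) c → HasColoredEdge G (φ x) (φ y) c
        -- The edge has some color `d` in `G`, which its image inherits; uniqueness of colors in
        -- `G′` forces `d ≡ c`.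
        reflect xy p with HasEdge⇒HasColoredEdge (preserves xy)
        ... | d , q = subst (HasColoredEdge G _ _) (HasColoredEdge-unique ff′ (transport q) p) q

        r′ : RainbowCopy H G′
        r′ = record
          { embedding = mk↣ λ {x} {y} eq →
              Injection.injective embedding (f-inj (φ∈vs x) (φ∈vs y) eq)
          ; preserves = λ xy → HasColoredEdge⇒HasEdge (transport (proj₂ (HasEdge⇒HasColoredEdge (preserves xy))))
          ; rainbow   = λ xy zw p q → rainbow xy zw (reflect xy p) (reflect zw q)
          }

      builderForces? : U.Decidable (BuilderForces H)
      builderForces? t = map′ (suc (2 * t) ,_) shrink (FirstFit-search (RainbowCopy H) rainbowCopy? t)

  -- The lower bound

  Sumℕ-mono : ∀ {n} {f g : Fin n → ℕ} → (∀ i → f i ≤ g i) → Sumℕ.sum f ≤ Sumℕ.sum g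
  Sumℕ-mono {zero}  _   = z≤n
  Sumℕ-mono {suc n} f≤g = ℕ.+-mono-≤ (f≤g zero) (Sumℕ-mono (f≤g ∘ suc))

  -- By pigeonhole, one of `suc n` distinct values is at least `n`; remove it and induct. This is
  -- the bound 0 + 1 + ... + (n - 1) without division.
  sum-injective : ∀ {n} {f : Fin n → ℕ} → Injective _≡_ _≡_ f → n * n ≤ 2 * Sumℕ.sum f + n
  sum-injective {zero}  _ = z≤n
  sum-injective {suc n} {f} f-inj with Fin.any? (λ x → n ℕ.≤? f x)
  ... | no none = contradiction
    (Fin.injective⇒≤ {f = λ x → fromℕ< (f<n x)} λ eq → f-inj (Fin.fromℕ<-injective _ _ _ _ eq))
    ℕ.1+n≰n
    where
    f<n : ∀ x → f x < n
    f<n x = ℕ.≰⇒> λ n≤ → none (x , n≤)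
  ... | yes (x , n≤fx) = begin
    suc n * suc n                              ≡⟨ square n ⟩
    n * n + (2 * n + 1)                        ≤⟨ ℕ.+-mono-≤ (sum-injective f′-inj) (ℕ.+-monoˡ-≤ 1 (ℕ.*-monoʳ-≤ 2 n≤fx)) ⟩
    2 * S′ + n + (2 * f x + 1)                 ≡⟨ regroup S′ n (f x) ⟩
    2 * (f x + S′) + suc n                     ≡⟨ cong (λ s → 2 * s + suc n) (Sumℕ.sum-remove {i = x} f) ⟨
    2 * Sumℕ.sum f + suc n                     ∎
    where
    open ℕ.≤-Reasoning
    S′ = Sumℕ.sum (f ∘ punchIn x)
    f′-inj : Injective _≡_ _≡_ (f ∘ punchIn x)
    f′-inj = Fin.punchIn-injective x _ _ ∘ f-inj
    square : ∀ n → suc n * suc n ≡ n * n + (2 * n + 1)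
    square = solve-∀
    regroup : ∀ s n y → 2 * s + n + (2 * y + 1) ≡ 2 * (y + s) + suc n
    regroup = solve-∀

  𝟙 : ∀ {P : Set} → Dec P → ℕ
  𝟙 P? = if does P? then 1 else 0

  𝟙-⊎ : ∀ {P Q : Set} (P? : Dec P) (Q? : Dec Q) → 𝟙 (P? ⊎-dec Q?) ≤ 𝟙 P? + 𝟙 Q?
  𝟙-⊎ (yes _) _ = s≤s z≤n
  𝟙-⊎ (no  _) _ = ℕ.≤-refl

  𝟙-no : ∀ {P : Set} (P? : Dec P) → ¬ P → 𝟙 P? ≡ 0
  𝟙-no (yes p) ¬p = contradiction p ¬p
  𝟙-no (no _)  _  = refl

  length-filter-∷ : ∀ {A : Set} {P : A → Set} (P? : U.Decidable P) x xs →
                    length (filter P? (x ∷ xs)) ≡ 𝟙 (P? x) + length (filter P? xs)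
  length-filter-∷ P? x xs with does (P? x)
  ... | true  = refl
  ... | false = refl

  sum-fibre : ∀ {k n} {h : Fin k → Fin n} → Injective _≡_ _≡_ h → ∀ u →
              Sumℕ.sum (λ x → 𝟙 (u Fin.≟ h x)) ≤ 1
  sum-fibre {zero}  _ _ = z≤n
  sum-fibre {suc k} {h = h} h-inj u with u Fin.≟ h zero
  ... | no _     = sum-fibre (Fin.suc-injective ∘ h-inj) u
  ... | yes refl = s≤s (ℕ.≤-reflexive (trans
    (Sumℕ.sum-cong-≗ λ x → 𝟙-no (h zero Fin.≟ h (suc x)) (Fin.0≢1+n ∘ h-inj))
    (Sumℕ.sum-replicate-zero k)))

  -- Choosing an entry of each kind is injective, because no entry has two kinds.
  length≥kinds : ∀ {A : Set} (Q : ℕ → A → Set) → (∀ {i j x} → Q i x → Q j x → i ≡ j) →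
                 ∀ m (xs : List A) → (∀ {i} → i < m → Any (Q i) xs) → m ≤ length xs
  length≥kinds Q Q-disjoint m xs has = Fin.injective⇒≤ {f = λ i → Any.index (has (Fin.toℕ<n i))}
    λ {i} {j} eq → Fin.toℕ-injective (Q-disjoint
      (subst (λ l → Q (toℕ i) (lookup xs l)) eq (Any.lookup-index (has (Fin.toℕ<n i))))
      (Any.lookup-index (has (Fin.toℕ<n j))))

  Any-filter : ∀ {A : Set} {P Q : A → Set} (P? : U.Decidable P) {xs} →
               Any (λ x → P x × Q x) xs → Any Q (filter P? xs)
  Any-filter P? p with find p
  ... | x , x∈xs , px , qx = Any.map (λ { refl → qx }) (∈-filter⁺ P? x∈xs px)

  -- The cyclic successor, and counting edges that meet a rainbow cycle.

  module _ {k : ℕ} where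

    next : Fin k → Fin k
    next x with suc (toℕ x) ℕ.<? k
    ... | yes x+1<k = fromℕ< x+1<k
    ... | no  _     = fromℕ< {0} (ℕ.≤-<-trans z≤n (Fin.toℕ<n x))

    next-Next : ∀ x → Next x (next x)
    next-Next x with suc (toℕ x) ℕ.<? k
    ... | yes x+1<k = inj₁ (Fin.toℕ-fromℕ< x+1<k)
    ... | no  x+1≮k = inj₂ (ℕ.≤-antisym (Fin.toℕ<n x) (ℕ.≮⇒≥ x+1≮k) , Fin.toℕ-fromℕ< _)

    Next-injective : ∀ {x y z : Fin k} → Next x z → Next y z → x ≡ y
    Next-injective (inj₁ p) (inj₁ q) = Fin.toℕ-injective (ℕ.suc-injective (trans (sym p) q))
    Next-injective (inj₁ p) (inj₂ (_ , q)) = contradiction (trans (sym p) q) ℕ.1+n≢0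
    Next-injective (inj₂ (_ , p)) (inj₁ q) = contradiction (trans (sym q) p) ℕ.1+n≢0
    Next-injective (inj₂ (p , _)) (inj₂ (q , _)) =
      Fin.toℕ-injective (ℕ.suc-injective (trans p (sym q)))

    next-injective : Injective _≡_ _≡_ next
    next-injective {x} {y} eq = Next-injective (next-Next x) (subst (Next y) (sym eq) (next-Next y))

    -- Going around the end of the cycle and back in two steps would force `k ≤ 2`.
    Next-asym : 3 ≤ k → ∀ {x y : Fin k} → Next x y → ¬ Next y x
    Next-asym 3≤k (inj₁ p) (inj₁ q) = ℕ.<-asym (ℕ.≤-reflexive (sym p)) (ℕ.≤-reflexive (sym q))
    Next-asym 3≤k (inj₁ p) (inj₂ (q , r)) =
      ℕ.<⇒≱ 3≤k (ℕ.≤-reflexive (trans (sym q) (cong suc (trans p (cong suc r)))))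
    Next-asym 3≤k (inj₂ (q , r)) (inj₁ p) =
      ℕ.<⇒≱ 3≤k (ℕ.≤-reflexive (trans (sym q) (cong suc (trans p (cong suc r)))))
    Next-asym 3≤k (inj₂ (_ , p)) (inj₂ (q , _)) =
      ℕ.<⇒≱ 3≤k (ℕ.≤-trans (ℕ.≤-reflexive (trans (sym q) (cong suc p))) (s≤s z≤n))

    module _ (3≤k : 3 ≤ k) {n} {G : ColoredGraph n} (ff : FirstFit G)
             (copy : RainbowCopy (cycle k 3≤k) G) where
      open RainbowCopy copy

      private
        L : List ((Fin n × Fin n) × ℕ)
        L = map bare G

        cycleEdge : Fin k → Fin n × Fin n
        cycleEdge x = φ x , φ (next x)

        colored : ∀ x → ∃ (HasColoredEdge G (φ x) (φ (next x)))
        colored x = HasEdge⇒HasColoredEdge (preserves (inj₁ (next-Next x)))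

        γ : Fin k → ℕ
        γ x = proj₁ (colored x)

        φ-inj : Injective _≡_ _≡_ φ
        φ-inj = Injection.injective embedding

        γ-injective : Injective _≡_ _≡_ γ
        γ-injective {x} {y} eq
          with rainbow (inj₁ (next-Next x)) (inj₁ (next-Next y)) (proj₂ (colored x))
                 (subst (HasColoredEdge G _ _) (sym eq) (proj₂ (colored y)))
        ... | inj₁ (x≡y , _) = x≡y
        -- With exchanged ends, `x` and `next x` would be successors of each other.
        ... | inj₂ (x≡ny , nx≡y) = contradiction
          (subst (λ z → Next z x) nx≡y (subst (Next (next x)) (sym x≡ny)
            (subst (λ z → Next z (next y)) (sym nx≡y) (next-Next y))))
          (Next-asym 3≤k (subst (Next x) nx≡y (next-Next x)))

        load : List ((Fin n × Fin n) × ℕ) → Fin k → ℕ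
        load F x = length (filter (meets? (cycleEdge x)) F)

      -- Double counting: each of the two ends of a presented edge equals `φ x` for at most one `x`
      -- and `φ (next x)` for at most one `x`.
      sum-load : ∀ F → Sumℕ.sum (load F) ≤ 4 * length F
      sum-load [] = ℕ.≤-reflexive (Sumℕ.sum-replicate-zero k)
      sum-load (f@((u , v) , _) ∷ F) = begin
        Sumℕ.sum (load (f ∷ F))
          ≡⟨ Sumℕ.sum-cong-≗ (λ x → length-filter-∷ (meets? (cycleEdge x)) f F) ⟩
        Sumℕ.sum (λ x → 𝟙 (meets? (cycleEdge x) f) + load F x)
          ≡⟨ Sumℕ.∑-distrib-+ (λ x → 𝟙 (meets? (cycleEdge x) f)) (load F) ⟩
        Sumℕ.sum (λ x → 𝟙 (meets? (cycleEdge x) f)) + Sumℕ.sum (load F)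
          ≤⟨ ℕ.+-mono-≤ four (sum-load F) ⟩
        4 + 4 * length F
          ≡⟨ ℕ.*-suc 4 (length F) ⟨
        4 * length (f ∷ F) ∎
        where
        open ℕ.≤-Reasoning
        at : Fin n → (Fin k → Fin n) → Fin k → ℕ
        at w h x = 𝟙 (w Fin.≟ h x)

        φn-inj : Injective _≡_ _≡_ (φ ∘ next)
        φn-inj = next-injective ∘ φ-inj

        half : ∀ {h} → Injective _≡_ _≡_ h → Sumℕ.sum (λ x → 𝟙 (u Fin.≟ h x ⊎-dec v Fin.≟ h x)) ≤ 2
        half {h} h-inj = begin
          Sumℕ.sum (λ x → 𝟙 (u Fin.≟ h x ⊎-dec v Fin.≟ h x))
            ≤⟨ Sumℕ-mono (λ x → 𝟙-⊎ (u Fin.≟ h x) (v Fin.≟ h x)) ⟩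
          Sumℕ.sum (λ x → at u h x + at v h x)
            ≡⟨ Sumℕ.∑-distrib-+ (at u h) (at v h) ⟩
          Sumℕ.sum (at u h) + Sumℕ.sum (at v h)
            ≤⟨ ℕ.+-mono-≤ (sum-fibre h-inj u) (sum-fibre h-inj v) ⟩
          2 ∎

        four : Sumℕ.sum (λ x → 𝟙 (meets? (cycleEdge x) f)) ≤ 4
        four = begin
          Sumℕ.sum (λ x → 𝟙 (meets? (cycleEdge x) f))
            ≤⟨ Sumℕ-mono (λ x → 𝟙-⊎ (u Fin.≟ φ x ⊎-dec v Fin.≟ φ x)
                                    (u Fin.≟ φ (next x) ⊎-dec v Fin.≟ φ (next x))) ⟩
          Sumℕ.sum (λ x → 𝟙 (u Fin.≟ φ x ⊎-dec v Fin.≟ φ x)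
                        + 𝟙 (u Fin.≟ φ (next x) ⊎-dec v Fin.≟ φ (next x)))
            ≡⟨ Sumℕ.∑-distrib-+ (λ x → 𝟙 (u Fin.≟ φ x ⊎-dec v Fin.≟ φ x)) _ ⟩
          Sumℕ.sum (λ x → 𝟙 (u Fin.≟ φ x ⊎-dec v Fin.≟ φ x))
            + Sumℕ.sum (λ x → 𝟙 (u Fin.≟ φ (next x) ⊎-dec v Fin.≟ φ (next x)))
            ≤⟨ ℕ.+-mono-≤ (half φ-inj) (half φn-inj) ⟩
          4 ∎

      rainbow-cycle-size : k * k ≤ 8 * length G + k
      rainbow-cycle-size = begin
        k * k                       ≤⟨ sum-injective pred-injective ⟩
        2 * Sumℕ.sum pred-γ + k     ≤⟨ ℕ.+-monoˡ-≤ k (ℕ.*-monoʳ-≤ 2 (ℕ.≤-trans (Sumℕ-mono pred-γ≤load) (sum-load L))) ⟩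
        2 * (4 * length L) + k      ≡⟨ cong (_+ k) (ℕ.*-assoc 2 4 (length L)) ⟨
        8 * length L + k            ≡⟨ cong (λ l → 8 * l + k) (length-map bare G) ⟩
        8 * length G + k            ∎
        where
        open ℕ.≤-Reasoning
        pred-γ : Fin k → ℕ
        pred-γ x = γ x ∸ 1

        colored′ : ∀ x → Any (λ f → SamePair (proj₁ f) (cycleEdge x) × proj₂ f ≡ γ x) L
        colored′ x = Any.map⁺ (proj₂ (colored x))

        pred-injective : Injective _≡_ _≡_ pred-γ
        pred-injective {x} {y} eq = γ-injective
          (ℕ.∸-cancelʳ-≡ (1≤color (FirstFit⇒Greedy ff) (colored′ x)) (1≤color (FirstFit⇒Greedy ff) (colored′ y)) eq)

        pred-γ≤load : ∀ x → pred-γ x ≤ load L x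
        -- The colors `suc j` with `j < pred-γ x` are those below `γ x`, and each occurs on an edge
        -- that meets the cycle edge.
        pred-γ≤load x = length≥kinds (λ j f → proj₂ f ≡ suc j)
          (λ p q → ℕ.suc-injective (trans (sym p) q)) (pred-γ x) _
          λ j<pred → Any-filter (meets? (cycleEdge x))
            (smaller-color-met (FirstFit⇒Greedy ff) (colored′ x) (s≤s z≤n) (ℕ.pred-cancel-< j<pred))

  -- The construction

  module _ {A : Set} where

    -- The edges of a matching do not obstruct one another, and `G` has only colors below `c`; hence
    -- all of `C` can receive the same color, in any order.
    Greedy-++ : ∀ {G c} (C : List (A × A)) → 1 ≤ c → Greedy G → All (λ f → proj₂ f < c) G →
                AllPairs (λ e f → ¬ Meets f e) C →
                (∀ {e} → e ∈ C → proj₁ e ≢ proj₂ e) →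
                (∀ {e} → e ∈ C → All (λ f → ¬ SamePair (proj₁ f) e) G) →
                (∀ {e j} → e ∈ C → 1 ≤ j → j < c → Any (λ f → Meets (proj₁ f) e × proj₂ f ≡ j) G) →
                Greedy (map (_, c) C ++ G)
    Greedy-++ [] _ g _ _ _ _ _ = g
    Greedy-++ (e ∷ C) 1≤c g old (disjoint ∷ matching) loopless new below =
      present (Greedy-++ C 1≤c g old matching (loopless ∘ there) (new ∘ there) (below ∘ there))
        (loopless (here refl))
        (All.++⁺ (All.map⁺ (All.map (_∘ SamePair⇒Meets) disjoint)) (new (here refl)))
        1≤c
        (All.++⁺ (All.map⁺ (All.map (λ ≁ m → contradiction m ≁) disjoint))
                 (All.map (λ j<c _ → ℕ.<⇒≢ j<c) old))
        (λ 1≤j j<c → Any.++⁺ʳ (map (_, _) C) (below (here refl) 1≤j j<c))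

    -- R c lists the edges of color c + 1.
    layers : (ℕ → List (A × A)) → ℕ → List ((A × A) × ℕ)
    layers R zero    = []
    layers R (suc c) = map (_, suc c) (R c) ++ layers R c

    module _ (R : ℕ → List (A × A)) where

      layers-All : ∀ c → All (λ f → ∃ λ j → j < c × proj₁ f ∈ R j × proj₂ f ≡ suc j) (layers R c)
      layers-All zero    = []
      layers-All (suc c) = All.++⁺
        (All.map⁺ (All.tabulate λ e∈ → c , ℕ.≤-refl , e∈ , refl))
        (All.map (λ (j , j<c , rest) → j , ℕ.m<n⇒m<1+n j<c , rest) (layers-All c))

      layers-Any : ∀ {P : A × A → Set} {j} c → j < c → Any P (R j) →
                   Any (λ f → P (proj₁ f) × proj₂ f ≡ suc j) (layers R c)
      layers-Any {j = j} (suc c) j<1+c p with j ℕ.≟ c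
      ... | yes refl = Any.++⁺ˡ (Any.map⁺ (Any.map (_, refl) p))
      ... | no  j≢c  = Any.++⁺ʳ (map (_, suc c) (R c)) (layers-Any c (ℕ.≤∧≢⇒< (s≤s⁻¹ j<1+c) j≢c) p)

      -- Reduces the check of First-Fit to conditions on the rounds alone: each is a loopless
      -- matching, no two share an edge, and every edge meets all earlier rounds.
      layers-Greedy : ∀ n →
        (∀ {c} → c < n → AllPairs (λ e f → ¬ Meets f e) (R c)) →
        (∀ {c e} → c < n → e ∈ R c → proj₁ e ≢ proj₂ e) →
        (∀ {c j e f} → c < n → j < c → e ∈ R c → f ∈ R j → ¬ SamePair f e) →
        (∀ {c j e} → c < n → j < c → e ∈ R c → Any (λ f → Meets f e) (R j)) →
        Greedy (layers R n)
      layers-Greedy zero _ _ _ _ = []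
      layers-Greedy (suc n) matching loopless simple saturated = Greedy-++ (R n) (s≤s z≤n)
        (layers-Greedy n (matching ∘ ℕ.m<n⇒m<1+n) (loopless ∘ ℕ.m<n⇒m<1+n)
                         (simple ∘ ℕ.m<n⇒m<1+n) (saturated ∘ ℕ.m<n⇒m<1+n))
        (All.map (λ { (j , j<n , _ , refl) → s≤s j<n }) (layers-All n))
        (matching ℕ.≤-refl) (loopless ℕ.≤-refl)
        (λ e∈ → All.map (λ { (j , j<n , f∈ , refl) → simple ℕ.≤-refl j<n e∈ f∈ }) (layers-All n))
        (λ { {j = suc j} e∈ (s≤s _) (s≤s j<n) → layers-Any n j<n (saturated ℕ.≤-refl j<n e∈) })

  -- Certificates for linear arithmetic: the hypotheses are added up to l ≤ r, and d is the
  -- slack that turns the comparison with the goal into a semiring identity.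
  lin⊥ : ∀ {l r} d → l ≤ r → ¬ (l ≡ suc (r + d))
  lin⊥ {r = r} d l≤r refl = ℕ.<⇒≱ (s≤s (ℕ.m≤m+n r d)) l≤r

  lin≤ : ∀ {l r x y} d → l ≤ r → x + r + d ≡ y + l → x ≤ y
  lin≤ {l} {r} {x} {y} d l≤r eq = ℕ.+-cancelʳ-≤ r x y (ℕ.≤-trans (ℕ.m≤m+n (x + r) d)
    (ℕ.≤-trans (ℕ.≤-reflexive eq) (ℕ.+-monoʳ-≤ y l≤r)))

  infixr 6 _⊕_
  _⊕_ : ∀ {a b c d} → a ≤ b → c ≤ d → a + c ≤ b + d
  _⊕_ = ℕ.+-mono-≤

  ≡⇒≤ : ∀ {a b : ℕ} → a ≡ b → a ≤ b
  ≡⇒≤ = ℕ.≤-reflexive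

  -- Doubling is written `m * 2` because `suc m * 2` unfolds to `2 + m * 2`, so that many equations
  -- hold by computation.
  parity : ∀ n → ∃ λ m → n ≡ m * 2 ⊎ n ≡ 1 + m * 2
  parity zero    = 0 , inj₁ refl
  parity (suc n) with parity n
  ... | m , inj₁ refl = m , inj₂ refl
  ... | m , inj₂ refl = suc m , inj₁ refl

  odd≢even : ∀ a b → 1 + a * 2 ≢ b * 2
  odd≢even zero    zero          ()
  odd≢even zero    (suc b)       ()
  odd≢even (suc a) (suc b) eq    = odd≢even a b (ℕ.suc-injective (ℕ.suc-injective eq))

  -- The number of hubs in round χ: hub a takes part iff 4 + 4a ≤ χ or χ is 1 + 4a or 3 + 4a,
  -- and this is downward closed in a.
  hubs : ℕ → ℕ
  hubs 0 = 0
  hubs 1 = 1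
  hubs 2 = 0
  hubs 3 = 1
  hubs (suc (suc (suc (suc χ)))) = suc (hubs χ)

  <hubs : ∀ a {χ} → 4 + a * 4 ≤ χ → a < hubs χ
  <hubs zero    (s≤s (s≤s (s≤s (s≤s _)))) = s≤s z≤n
  <hubs (suc a) (s≤s (s≤s (s≤s (s≤s p)))) = s≤s (<hubs a p)

  <hubs-1 : ∀ a → a < hubs (1 + a * 4)
  <hubs-1 zero    = s≤s z≤n
  <hubs-1 (suc a) = s≤s (<hubs-1 a)

  <hubs-3 : ∀ a → a < hubs (3 + a * 4)
  <hubs-3 zero    = s≤s z≤n
  <hubs-3 (suc a) = s≤s (<hubs-3 a)

  <hubs⇒≤ : ∀ a χ → a < hubs χ → 1 + a * 4 ≤ χ
  <hubs⇒≤ a       2 ()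
  <hubs⇒≤ zero    (suc χ) _ = s≤s z≤n
  <hubs⇒≤ (suc a) 1 (s≤s ())
  <hubs⇒≤ (suc a) 3 (s≤s ())
  <hubs⇒≤ (suc a) (suc (suc (suc (suc χ)))) (s≤s p) = s≤s (s≤s (s≤s (s≤s (<hubs⇒≤ a χ p))))

  -- The exceptional values `1 + a * 4` and `3 + a * 4` are odd.
  <hubs-even⇒≤ : ∀ a s → a < hubs (s * 2) → 4 + a * 4 ≤ s * 2
  <hubs-even⇒≤ zero    (suc (suc s)) _       = s≤s (s≤s (s≤s (s≤s z≤n)))
  <hubs-even⇒≤ (suc a) (suc (suc s)) (s≤s p) = s≤s (s≤s (s≤s (s≤s (<hubs-even⇒≤ a s p))))

  -- Source of the leading term: a round of value `χ` has about `χ / 4` edges, and these add up to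
  -- about k²/8.
  hubs*4≤ : ∀ χ → hubs χ * 4 ≤ 3 + χ
  hubs*4≤ 0 = z≤n
  hubs*4≤ 1 = ℕ.≤-refl
  hubs*4≤ 2 = z≤n
  hubs*4≤ 3 = ℕ.m≤n+m 4 2
  hubs*4≤ (suc (suc (suc (suc χ)))) = s≤s (s≤s (s≤s (s≤s (hubs*4≤ χ))))

  -- Hub a is node (1 + 2a); leaf a χ is the fresh end of its pendant edge in round χ.
  Vertex : Set
  Vertex = ℕ ⊎ (ℕ × ℕ)

  pattern node n   = inj₁ n
  pattern leaf a χ = inj₂ (a , χ)

  _≟ᵛ_ : DecidableEquality Vertex
  _≟ᵛ_ = ⊎.≡-dec ℕ._≟_ (×.≡-dec ℕ._≟_ ℕ._≟_)

  -- The relational form of `partner` avoids truncated subtraction. With r = 1 + 2a, `chord` says t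
  -- ≥ r + 2 and χ = r + t + 2.
  data Partner (χ a : ℕ) : Vertex → Set where
    pendant : Partner χ a (leaf a χ)
    chord   : ∀ {t} → 3 + a * 2 ≤ t → t + (3 + a * 2) ≡ χ → Partner χ a (node t)

  partner : ℕ → ℕ → Vertex
  partner χ a with 6 + a * 4 ℕ.≤? χ
  -- With r = 1 + 2a, the end t = χ - (r + 2) satisfies t ≥ r + 2 exactly when χ ≥ 2r + 4 = 6 + 4a.
  ... | yes _ = node (χ ∸ (3 + a * 2))
  ... | no  _ = leaf a χ

  partner-Partner : ∀ χ a → Partner χ a (partner χ a)
  partner-Partner χ a with 6 + a * 4 ℕ.≤? χ
  ... | no  _ = pendant
  ... | yes p = chord (lin≤ 0 (p ⊕ ≡⇒≤ (sym eq)) (E₁ a χ (χ ∸ (3 + a * 2)))) eq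
    where
    E₁ : ∀ a χ t → 3 + a * 2 + (χ + (t + (3 + a * 2))) + 0 ≡ t + (6 + a * 4 + χ)
    E₁ = solve-∀
    E₂ : ∀ a χ → 3 + a * 2 + χ + (3 + a * 2) ≡ χ + (6 + a * 4)
    E₂ = solve-∀
    eq : χ ∸ (3 + a * 2) + (3 + a * 2) ≡ χ
    eq = ℕ.m∸n+n≡m {χ} {3 + a * 2} (lin≤ (3 + a * 2) p (E₂ a χ))

  chord-partner : ∀ {χ a t} → 3 + a * 2 ≤ t → t + (3 + a * 2) ≡ χ → partner χ a ≡ node t
  chord-partner {χ} {a} {t} p q with 6 + a * 4 ℕ.≤? χ
  ... | yes _ = cong node (trans (cong (_∸ (3 + a * 2)) (sym q)) (ℕ.m+n∸n≡m t (3 + a * 2)))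
  ... | no ≰χ = contradiction (lin≤ 0 (p ⊕ ≡⇒≤ q) (E₁ a χ t)) ≰χ
    where
    E₁ : ∀ a χ t → 6 + a * 4 + (t + χ) + 0 ≡ χ + (3 + a * 2 + (t + (3 + a * 2)))
    E₁ = solve-∀

  hubEdge : ℕ → ℕ → Vertex × Vertex
  hubEdge χ a = node (1 + a * 2) , partner χ a

  hubEdges : ℕ → List (Vertex × Vertex)
  hubEdges χ = map (hubEdge χ) (upTo (hubs χ))

  ∈-hubEdges⁺ : ∀ χ {a} → a < hubs χ → hubEdge χ a ∈ hubEdges χ
  ∈-hubEdges⁺ χ a< = ∈-map⁺ (hubEdge χ) (∈-upTo⁺ a<)

  ∈-hubEdges⁻ : ∀ χ {e} → e ∈ hubEdges χ → ∃ λ a → a < hubs χ × e ≡ hubEdge χ a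
  ∈-hubEdges⁻ χ e∈ with ∈-map⁻ (hubEdge χ) e∈
  ... | a , a∈ , eq = a , ∈-upTo⁻ a∈ , eq

  -- Nodes 4, …, k + 3 form the cycle.  Round i, of value χ = 6 + i, presents its edge
  -- {4 + i, 5 + i} (or {k + 3, 4}) with color k - i, after the rounds with larger i.
  module Construction (k : ℕ) (3≤k : 3 ≤ k) where

    data CycleEnd (i : ℕ) : ℕ → Set where
      step  : suc i < k → CycleEnd i (5 + i)
      close : suc i ≡ k → CycleEnd i 4

    cycleEnd : ℕ → ℕ
    cycleEnd i with suc i ℕ.≟ k
    ... | yes _ = 4
    ... | no  _ = 5 + i

    cycleEnd-CycleEnd : ∀ {i} → i < k → CycleEnd i (cycleEnd i)
    cycleEnd-CycleEnd {i} i<k with suc i ℕ.≟ k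
    ... | yes eq = close eq
    ... | no ≢k  = step (ℕ.≤∧≢⇒< i<k ≢k)

    round : ℕ → List (Vertex × Vertex)
    round i = (node (4 + i) , node (cycleEnd i)) ∷ hubEdges (6 + i)

    data InRound (i : ℕ) : Vertex × Vertex → Set where
      cyc : ∀ {n} → CycleEnd i n → InRound i (node (4 + i) , node n)
      hub : ∀ a {v} → a < hubs (6 + i) → Partner (6 + i) a v → InRound i (node (1 + a * 2) , v)

    ∈-round : ∀ {i e} → i < k → e ∈ round i → InRound i e
    ∈-round i<k (here refl) = cyc (cycleEnd-CycleEnd i<k)
    ∈-round {i} i<k (there e∈) with ∈-hubEdges⁻ (6 + i) e∈
    ... | a , a< , refl = hub a a< (partner-Partner (6 + i) a)

    -- Each round is a matching.

    ¬close-at-1 : suc 1 ≢ k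
    ¬close-at-1 refl = contradiction 3≤k λ { (s≤s (s≤s ())) }

    -- Hubs of the round of value `χ` lie near `χ / 2` or below, whereas its cycle edge starts at
    -- `χ - 2`.
    hub-early : ∀ a {i n} → a < hubs (6 + i) → 4 + i ≤ n → 1 + a * 2 ≢ n
    hub-early a {i} {n} a< p eq =
      lin⊥ i (p ⊕ p ⊕ ≡⇒≤ (sym eq) ⊕ ≡⇒≤ (sym eq) ⊕ <hubs⇒≤ a _ a<) (E i a n)
      where
      E : ∀ i a n → 4 + i + (4 + i + (n + (n + (1 + a * 4)))) ≡
                    suc (n + (n + (1 + a * 2 + (1 + a * 2 + (6 + i)))) + i)
      E = solve-∀

    chord-early : ∀ a {i t} → t + (3 + a * 2) ≡ 6 + i → ¬ 4 + i ≤ t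
    chord-early a {i} {t} eq p = lin⊥ (a * 2) (≡⇒≤ eq ⊕ p) (E i a t)
      where
      E : ∀ i a t → t + (3 + a * 2) + (4 + i) ≡ suc (6 + i + t + a * 2)
      E = solve-∀

    -- The only chord ending at node 4 comes from hub 0 and has value 7, so it belongs to round 1;
    -- the closing edge belongs to round k - 1, which is at least 2.
    chord-4 : ∀ a {i} → suc i ≡ k → 3 + a * 2 ≤ 4 → 4 + (3 + a * 2) ≢ 6 + i
    chord-4 zero    c p eq = ¬close-at-1 (trans (ℕ.+-cancelˡ-≡ 5 2 _ eq) c)
    chord-4 (suc a) _ (s≤s (s≤s (s≤s (s≤s ())))) eq

    odd≢4 : ∀ a → 1 + a * 2 ≢ 4
    odd≢4 a = odd≢even a 2

    hub∉cycleEdge : ∀ a {i n} → a < hubs (6 + i) → CycleEnd i n → 1 + a * 2 ≢ n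
    hub∉cycleEdge a a< (step _)  = hub-early a a< (ℕ.n≤1+n _)
    hub∉cycleEdge a a< (close _) = odd≢4 a

    chord∉cycleEdge : ∀ a {i t n} → 3 + a * 2 ≤ t → t + (3 + a * 2) ≡ 6 + i → CycleEnd i n → t ≢ n
    chord∉cycleEdge a _ q (step _)  refl = chord-early a q (ℕ.n≤1+n _)
    chord∉cycleEdge a p q (close c) refl = chord-4 a c p q

    hub-¬Meets-cyc : ∀ a {i v n} → a < hubs (6 + i) → Partner (6 + i) a v → CycleEnd i n →
                     ¬ Meets (node (1 + a * 2) , v) (node (4 + i) , node n)
    hub-¬Meets-cyc a a< _ _           (inj₁ (inj₁ eq)) = hub-early a a< ℕ.≤-refl (⊎.inj₁-injective eq)
    hub-¬Meets-cyc a a< (chord p q) _ (inj₁ (inj₂ eq)) =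
      chord-early a q (≡⇒≤ (sym (⊎.inj₁-injective eq)))
    hub-¬Meets-cyc a a< _ end         (inj₂ (inj₁ eq)) = hub∉cycleEdge a a< end (⊎.inj₁-injective eq)
    hub-¬Meets-cyc a a< (chord p q) e (inj₂ (inj₂ eq)) = chord∉cycleEdge a p q e (⊎.inj₁-injective eq)

    -- Two hubs joined by a chord have an even χ, where no hub has a pendant edge below 4 + 4a.
    chord-to-hub : ∀ a b {χ} → a < b → b < hubs χ → ¬ 1 + b * 2 + (3 + a * 2) ≡ χ
    chord-to-hub a b a<b b< refl =
      lin⊥ 1 (a<b ⊕ a<b ⊕ <hubs-even⇒≤ b (2 + a + b) (subst (λ χ → b < hubs χ) (E₁ a b) b<)) (E₂ a b)
      where
      E₁ : ∀ a b → 1 + b * 2 + (3 + a * 2) ≡ (2 + a + b) * 2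
      E₁ = solve-∀
      E₂ : ∀ a b → suc a + (suc a + (4 + b * 4)) ≡ suc (b + (b + (2 + a + b) * 2) + 1)
      E₂ = solve-∀

    -- Chords lead upwards from their hub, by at least 2.
    chord-down : ∀ a b {t} → 3 + b * 2 ≤ t → t ≡ 1 + a * 2 → ¬ a ≤ b
    chord-down a b {t} p eq a≤b = lin⊥ 1 (p ⊕ ≡⇒≤ eq ⊕ a≤b ⊕ a≤b) (E a b t)
      where
      E : ∀ a b t → 3 + b * 2 + (t + (a + a)) ≡ suc (t + (1 + a * 2 + (b + b)) + 1)
      E = solve-∀

    hub-injective : ∀ a b → 1 + a * 2 ≡ 1 + b * 2 → a ≡ b
    hub-injective a b eq = ℕ.*-cancelʳ-≡ _ _ 2 (ℕ.suc-injective eq)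

    partner-injective : ∀ {χ a b v} → Partner χ a v → Partner χ b v → a ≡ b
    partner-injective pendant pendant = refl
    partner-injective {a = a} {b} (chord {t} _ p) (chord _ q) = ℕ.*-cancelʳ-≡ a b 2
      (ℕ.+-cancelˡ-≡ (t + 3) _ _ (trans (ℕ.+-assoc t 3 _) (trans p (trans (sym q) (sym (ℕ.+-assoc t 3 _))))))

    hubs-¬Meet : ∀ a b {χ v w} → a < b → b < hubs χ → Partner χ a v → Partner χ b w →
                 ¬ Meets (node (1 + b * 2) , w) (node (1 + a * 2) , v)
    hubs-¬Meet a b a<b b< _ _ (inj₁ (inj₁ eq)) =
      ℕ.<⇒≢ a<b (sym (hub-injective b a (⊎.inj₁-injective eq)))
    hubs-¬Meet a b a<b b< _ (chord p _) (inj₁ (inj₂ eq)) =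
      chord-down a b p (⊎.inj₁-injective eq) (ℕ.<⇒≤ a<b)
    hubs-¬Meet a b a<b b< (chord _ q) _ (inj₂ (inj₁ refl)) = chord-to-hub a b a<b b< q
    hubs-¬Meet a b a<b b< v∼ w∼ (inj₂ (inj₂ refl)) = ℕ.<⇒≢ a<b (partner-injective v∼ w∼)

    round-matching : ∀ {i} → i < k → AllPairs (λ e f → ¬ Meets f e) (round i)
    round-matching {i} i<k =
      All.tabulate (λ f∈ → case ∈-hubEdges⁻ (6 + i) f∈ of λ where
        (a , a< , refl) → hub-¬Meets-cyc a a< (partner-Partner (6 + i) a) (cycleEnd-CycleEnd i<k))
      ∷ hubEdges-matching (6 + i)
      where
      hubEdges-matching : ∀ χ → AllPairs (λ e f → ¬ Meets f e) (hubEdges χ)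
      hubEdges-matching χ = AllPairs.map⁺ (AllPairs.applyUpTo⁺₁ id (hubs χ)
        λ {a} {b} a<b b< → hubs-¬Meet a b a<b b< (partner-Partner χ a) (partner-Partner χ b))

    -- The presented graph is simple.

    InRound-loopless : ∀ {i e} → InRound i e → proj₁ e ≢ proj₂ e
    InRound-loopless (cyc (step _)) ()
    InRound-loopless (cyc (close refl)) refl = contradiction 3≤k λ { (s≤s ()) }
    InRound-loopless (hub a _ (chord p _)) refl = chord-down a a p refl ℕ.≤-refl

    -- Different cycle edges agreeing with ends exchanged would need a cycle of length 2.
    cycleEnd-determines : ∀ {i j m n} → CycleEnd i m → CycleEnd j n → 4 + i ≡ n → m ≡ 4 + j → i ≡ j
    cycleEnd-determines (step _)  (step _)  refl ()
    cycleEnd-determines (step _)  (close c) refl refl = contradiction c ¬close-at-1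
    cycleEnd-determines (close c) (step _)  refl refl = contradiction c ¬close-at-1
    cycleEnd-determines (close _) (close _) refl refl = refl

    -- A chord spans at least 2, a step only 1. The closing edge ends at 4, which is even, hence no
    -- hub, and too small to be the upper end of a chord from its other end.
    chord≢cycleEdge : ∀ {i n χ a v} → CycleEnd i n → Partner χ a v →
                      ¬ SamePair (node (4 + i) , node n) (node (1 + a * 2) , v)
    chord≢cycleEdge {i} (step _) (chord p _) (inj₁ (eq , refl)) =
      ℕ.1+n≰n (subst (λ m → 2 + m ≤ 5 + i) (sym (⊎.inj₁-injective eq)) p)
    chord≢cycleEdge {i} (step _) (chord p _) (inj₂ (refl , eq)) = contradiction
      (subst (λ m → 2 + m ≤ 4 + i) (sym (⊎.inj₁-injective eq)) p) (ℕ.<⇒≱ (s≤s (ℕ.m≤n+m (4 + i) 2)))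
    chord≢cycleEdge (close _) (chord p _) (inj₁ (eq , refl))
      with subst (λ m → 2 + m ≤ 4) (sym (⊎.inj₁-injective eq)) p
    ... | s≤s (s≤s (s≤s (s≤s ())))
    chord≢cycleEdge {a = a} (close _) (chord _ _) (inj₂ (_ , eq)) = odd≢4 a (sym (⊎.inj₁-injective eq))

    -- A leaf records its `χ`, and a chord {r, t} has χ = r + t + 2; since chords lead upwards,
    -- their ends cannot be exchanged.
    partners-determine : ∀ {χ ψ a b v w} → Partner χ a v → Partner ψ b w →
                         SamePair (node (1 + a * 2) , v) (node (1 + b * 2) , w) → χ ≡ ψ
    partners-determine pendant pendant (inj₁ (_ , refl)) = refl
    partners-determine {a = a} {b} (chord _ p) (chord _ q) (inj₁ (eq , refl))
      with hub-injective a b (⊎.inj₁-injective eq)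
    ... | refl = trans (sym p) q
    partners-determine {a = a} {b} (chord p _) (chord q _) (inj₂ (refl , refl)) =
      contradiction (ℕ.≰⇒≥ (chord-down b a p refl)) (chord-down a b q refl)

    rounds-disjoint : ∀ {i j e f} → InRound i e → InRound j f → SamePair e f → i ≡ j
    rounds-disjoint (cyc _) (cyc _) (inj₁ (refl , _)) = refl
    rounds-disjoint (cyc m) (cyc n) (inj₂ (p , q)) =
      cycleEnd-determines m n (⊎.inj₁-injective p) (⊎.inj₁-injective q)
    rounds-disjoint (cyc m) (hub _ _ v) same = contradiction same (chord≢cycleEdge m v)
    rounds-disjoint (hub _ _ v) (cyc m) same = contradiction (SamePair-sym same) (chord≢cycleEdge m v)
    rounds-disjoint (hub _ _ v) (hub _ _ w) same = ℕ.+-cancelˡ-≡ 6 _ _ (partners-determine v w same)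

    -- Every edge meets all rounds presented before its own.

    Sees : ℕ → ℕ → Set
    Sees i n = Any (λ f → proj₁ f ≡ node n ⊎ proj₂ f ≡ node n) (round i)

    sees-hub : ∀ a {i} → a < hubs (6 + i) → Sees i (1 + a * 2)
    sees-hub a {i} a< = there (Any.map (λ { refl → inj₁ refl }) (∈-hubEdges⁺ (6 + i) a<))

    sees-chord : ∀ a {i t} → 3 + a * 2 ≤ t → t + (3 + a * 2) ≡ 6 + i → Sees i t
    sees-chord a {i} {t} p q =
      there (Any.map (λ { refl → inj₂ (chord-partner p q) }) (∈-hubEdges⁺ (6 + i)
        (<hubs a (lin≤ {x = 4 + a * 4} {y = 6 + i} 2 (p ⊕ ≡⇒≤ q) (E i a t)))))
      where
      E : ∀ i a t → 4 + a * 4 + (t + (6 + i)) + 2 ≡ 6 + i + (3 + a * 2 + (t + (3 + a * 2)))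
      E = solve-∀

    sees-cycle : ∀ i → Sees i (4 + i)
    sees-cycle i = here (inj₁ refl)

    -- The value `2 + a * 4`, which hub `a` skips, is brought to its node by the shortest chord of
    -- the preceding hub.
    sees-hub-even : ∀ {i} a → 6 + i ≡ 2 + a * 4 → Sees i (1 + a * 2)
    sees-hub-even zero    ()
    sees-hub-even (suc b) eq = sees-chord b ℕ.≤-refl (trans (E b) (sym eq))
      where
      E : ∀ b → 3 + b * 2 + (3 + b * 2) ≡ 2 + suc b * 4
      E = solve-∀

    sees-hub-later : ∀ a {i j} → a < hubs (6 + i) → i < j → Sees j (1 + a * 2)
    sees-hub-later a {i} {j} a< i<j with 4 + a * 4 ℕ.≤? 6 + j | 6 + j ℕ.≟ 3 + a * 4 | 6 + j ℕ.≟ 2 + a * 4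
    ... | yes p | _ | _ = sees-hub a (<hubs a p)
    ... | no _ | yes eq | _ = sees-hub a (subst (λ χ → a < hubs χ) (sym eq) (<hubs-3 a))
    ... | no _ | no _ | yes eq = sees-hub-even a eq
    ... | no ≰ | no ≢3 | no ≢2 = contradiction
      (ℕ.≤∧≢⇒< (s≤s⁻¹ (ℕ.≤∧≢⇒< (s≤s⁻¹ (ℕ.≰⇒> ≰)) ≢3)) ≢2)
      (ℕ.≤⇒≯ (ℕ.≤-trans (s≤s (<hubs⇒≤ a (6 + i) a<)) (ℕ.+-monoʳ-≤ 6 i<j)))

    sees-hub-full : ∀ m {j} → 12 + m * 4 ≤ 6 + j → Sees j (5 + m * 2)
    sees-hub-full m p = sees-hub (2 + m) (<hubs (2 + m) p)

    -- Even values at hub 2 + m: chords from the hubs `q` up to `suc m` bring the smaller ones, and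
    -- its own edges the rest.
    sees-odd : ∀ m q {j} → j ≡ 2 + m * 2 + q * 2 → Sees j (5 + m * 2)
    sees-odd m q {j} refl with q ℕ.≤? suc m
    ... | yes q≤ = sees-chord q (ℕ.+-monoʳ-≤ 3 (ℕ.*-monoˡ-≤ 2 q≤)) (E m q)
      where
      E : ∀ m q → 5 + m * 2 + (3 + q * 2) ≡ 8 + m * 2 + q * 2
      E = solve-∀
    ... | no q≰ = sees-hub-full m
      (lin≤ {x = 12 + m * 4} {y = 8 + m * 2 + q * 2} 0 (ℕ.≰⇒> q≰ ⊕ ℕ.≰⇒> q≰) (E m q))
      where
      E : ∀ m q → 12 + m * 4 + (q + q) + 0 ≡ 8 + m * 2 + q * 2 + (2 + m + (2 + m))
      E = solve-∀

    cycle-saturated-odd : ∀ m q {j} → j ≡ 3 + m * 2 + q * 2 → Sees j (5 + m * 2) ⊎ Sees j (6 + m * 2)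
    cycle-saturated-odd m q refl with q ℕ.≤? suc m
    ... | yes q≤ = inj₂ (sees-chord q (ℕ.m≤n⇒m≤1+n (ℕ.+-monoʳ-≤ 3 (ℕ.*-monoˡ-≤ 2 q≤))) (E m q))
      where
      E : ∀ m q → 6 + m * 2 + (3 + q * 2) ≡ 9 + m * 2 + q * 2
      E = solve-∀
    ... | no q≰ = inj₁ (sees-hub-full m
      (lin≤ {x = 12 + m * 4} {y = 9 + m * 2 + q * 2} 1 (ℕ.≰⇒> q≰ ⊕ ℕ.≰⇒> q≰) (E m q)))
      where
      E : ∀ m q → 12 + m * 4 + (q + q) + 1 ≡ 9 + m * 2 + q * 2 + (2 + m + (2 + m))
      E = solve-∀

    -- Chords to the even end serve `q < m`. For r = 5 + 2m, the cases `q ≡ m` and `q ≡ suc m` are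
    -- the values 2r - 1 and 2r + 1, for which hub r has pendant edges; from then on it takes part
    -- in every round.
    cycle-saturated-even : ∀ m q {j} → j ≡ 3 + m * 2 + q * 2 → Sees j (4 + m * 2) ⊎ Sees j (5 + m * 2)
    cycle-saturated-even m q refl with q ℕ.<? m | q ℕ.≟ m | q ℕ.≟ suc m
    ... | yes q<m | _ | _ = inj₁ (sees-chord (suc q)
      (lin≤ {x = 5 + q * 2} {y = 4 + m * 2} 1 (q<m ⊕ q<m) (E₁ m q)) (E₂ m q))
      where
      E₁ : ∀ m q → 5 + q * 2 + (m + m) + 1 ≡ 4 + m * 2 + (suc q + suc q)
      E₁ = solve-∀
      E₂ : ∀ m q → 4 + m * 2 + (3 + suc q * 2) ≡ 9 + m * 2 + q * 2
      E₂ = solve-∀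
    ... | no _ | yes refl | _ =
      inj₂ (sees-hub (2 + m) (subst (λ χ → 2 + m < hubs χ) (E m) (<hubs-1 (2 + m))))
      where
      E : ∀ m → 1 + (2 + m) * 4 ≡ 9 + m * 2 + m * 2
      E = solve-∀
    ... | no _ | no _ | yes refl =
      inj₂ (sees-hub (2 + m) (subst (λ χ → 2 + m < hubs χ) (E m) (<hubs-3 (2 + m))))
      where
      E : ∀ m → 3 + (2 + m) * 4 ≡ 9 + m * 2 + suc m * 2
      E = solve-∀
    ... | no q≮m | no q≢m | no q≢1+m = inj₂ (sees-hub-full m
      (lin≤ {x = 12 + m * 4} {y = 9 + m * 2 + q * 2} 1 (q> ⊕ q>) (E m q)))
      where
      q> : suc m < q
      q> = ℕ.≤∧≢⇒< (ℕ.≤∧≢⇒< (ℕ.≮⇒≥ q≮m) (q≢m ∘ sym)) (q≢1+m ∘ sym)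
      E : ∀ m q → 12 + m * 4 + (q + q) + 1 ≡ 9 + m * 2 + q * 2 + (2 + m + (2 + m))
      E = solve-∀

    cycle-saturated : ∀ {i j} → i < j → Sees j (4 + i) ⊎ Sees j (5 + i)
    cycle-saturated {i} i<j with ℕ.m≤n⇒∃[o]m+o≡n i<j
    ... | d , refl with parity i | parity d
    ... | m , inj₂ refl | q , inj₁ refl = inj₁ (sees-odd m q refl)
    ... | m , inj₂ refl | q , inj₂ refl = cycle-saturated-odd m q (E m q)
      where
      E : ∀ m q → 2 + m * 2 + (1 + q * 2) ≡ 3 + m * 2 + q * 2
      E = solve-∀
    -- Here j = i + 1, and consecutive cycle edges share node 5 + i.
    ... | m , inj₁ refl | zero , inj₁ refl =
      inj₂ (subst (Sees _) (cong (5 +_) (ℕ.+-identityʳ _)) (sees-cycle _))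
    ... | m , inj₁ refl | suc q , inj₁ refl = cycle-saturated-even m q (E m q)
      where
      E : ∀ m q → 1 + m * 2 + suc q * 2 ≡ 3 + m * 2 + q * 2
      E = solve-∀
    ... | m , inj₁ refl | q , inj₂ refl = inj₂ (sees-odd m q (E m q))
      where
      E : ∀ m q → 1 + m * 2 + (1 + q * 2) ≡ 2 + m * 2 + q * 2
      E = solve-∀

    round-saturated : ∀ {i j e} → i < j → j < k → InRound i e → Any (λ f → Meets f e) (round j)
    round-saturated i<j _ (hub a a< _) = Any.map inj₁ (sees-hub-later a a< i<j)
    -- The closing edge is in the round presented first, so no earlier round exists.
    round-saturated i<j j<k (cyc (close refl)) = contradiction j<k (ℕ.≤⇒≯ i<j)
    round-saturated i<j _ (cyc (step _)) with cycle-saturated i<j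
    ... | inj₁ s = Any.map inj₁ s
    ... | inj₂ s = Any.map inj₂ s

    -- The whole history and its length.

    roundOf : ℕ → List (Vertex × Vertex)
    roundOf c = round (k ∸ suc c)

    k∸suc<k : ∀ {c} → c < k → k ∸ suc c < k
    k∸suc<k c<k = ℕ.∸-monoʳ-< (s≤s z≤n) c<k

    history : List ((Vertex × Vertex) × ℕ)
    history = layers roundOf k

    history-Greedy : Greedy history
    history-Greedy = layers-Greedy roundOf k
      (round-matching ∘ k∸suc<k)
      (λ c<k → InRound-loopless ∘ ∈-round (k∸suc<k c<k))
      (λ c<k j<c e∈ f∈ same → ℕ.<⇒≢ (later c<k j<c)
        (sym (rounds-disjoint (∈-round (k∸suc<k (ℕ.<-trans j<c c<k)) f∈) (∈-round (k∸suc<k c<k) e∈) same)))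
      (λ c<k j<c e∈ → round-saturated (later c<k j<c) (k∸suc<k (ℕ.<-trans j<c c<k)) (∈-round (k∸suc<k c<k) e∈))
      where
      later : ∀ {c j} → c < k → j < c → k ∸ suc c < k ∸ suc j
      later c<k j<c = ℕ.∸-monoʳ-< (s≤s j<c) c<k

    layer-of-round : ∀ {i} → i < k → k ∸ suc (k ∸ suc i) ≡ i
    layer-of-round {i} i<k = trans (cong (k ∸_) (sym (ℕ.+-∸-assoc 1 i<k))) (ℕ.m∸[m∸n]≡n (ℕ.<⇒≤ i<k))

    cycleEdge-colored : ∀ {i} → i < k →
      Any (λ f → SamePair (proj₁ f) (node (4 + i) , node (cycleEnd i)) × proj₂ f ≡ k ∸ i) history
    cycleEdge-colored {i} i<k = Any.map (map₂ λ eq → trans eq (sym (ℕ.+-∸-assoc 1 i<k)))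
      (layers-Any roundOf k (k∸suc<k i<k)
        (subst (λ j → Any (λ f → SamePair f (node (4 + i) , node (cycleEnd i))) (round j))
          (sym (layer-of-round i<k)) (here (inj₁ (refl , refl)))))

    -- The square is a potential. For i = k - n - 1 the new round contributes at most 26 + 2i to the
    -- left side; the potential drops by 2i + 1, and the remaining 25 goes into the error term.
    length-layers : ∀ {n} → n ≤ k →
                    8 * length (layers roundOf n) + (k ∸ n) * (k ∸ n) ≤ k * k + 25 * n
    length-layers {zero}  _   = ≡⇒≤ (sym (ℕ.+-identityʳ (k * k)))
    length-layers {suc n} n<k = begin
      8 * length (layers roundOf (suc n)) + i * i
        ≡⟨ cong (λ l → 8 * l + i * i) length-layer ⟩
      8 * (suc (hubs (6 + i)) + l) + i * i
        ≤⟨ lin≤ {y = 25 + (8 * l + suc i * suc i)} 0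
             (hubs*4≤ (6 + i) ⊕ hubs*4≤ (6 + i)) (E i (hubs (6 + i)) l) ⟩
      25 + (8 * l + suc i * suc i)
        ≡⟨ cong (λ j → 25 + (8 * l + j * j)) (ℕ.+-∸-assoc 1 n<k) ⟨
      25 + (8 * l + (k ∸ n) * (k ∸ n))
        ≤⟨ ℕ.+-monoʳ-≤ 25 (length-layers (ℕ.<⇒≤ n<k)) ⟩
      25 + (k * k + 25 * n)
        ≡⟨ E′ k n ⟩
      k * k + 25 * suc n ∎
      where
      open ℕ.≤-Reasoning
      i = k ∸ suc n
      l = length (layers roundOf n)
      length-layer : length (layers roundOf (suc n)) ≡ suc (hubs (6 + i)) + l
      length-layer = trans (length-++ (map (_, suc n) (round i))) (cong (_+ l)
        (trans (length-map (_, suc n) (round i))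
          (cong suc (trans (length-map (hubEdge (6 + i)) (upTo (hubs (6 + i)))) (length-upTo (hubs (6 + i)))))))
      E : ∀ i h l → 8 * (suc h + l) + i * i + (9 + i + (9 + i)) + 0 ≡
                    25 + (8 * l + suc i * suc i) + (h * 4 + h * 4)
      E = solve-∀
      E′ : ∀ k n → 25 + (k * k + 25 * n) ≡ k * k + 25 * suc n
      E′ = solve-∀

    length-history : 8 * length history ≤ k * k + 25 * k
    length-history = ℕ.m+n≤o⇒m≤o _ (length-layers ℕ.≤-refl)

    -- The rainbow cycle inside the history.

    private
      f : Vertex → Fin (suc (length (endpoints history)))
      f = position _≟ᵛ_ (endpoints history)

      G : ColoredGraph _
      G = map dress (map (relabel f) history)

      φ : Fin k → Fin (suc (length (endpoints history)))
      φ x = f (node (4 + toℕ x))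

    G-FirstFit : FirstFit G
    G-FirstFit = Greedy⇒FirstFit (Greedy-relabel f (position-injective _≟ᵛ_ (endpoints history))
      (ends∈endpoints history) history-Greedy)

    φ-injective : ∀ {x y} → φ x ≡ φ y → x ≡ y
    φ-injective {x} {y} eq = Fin.toℕ-injective (ℕ.+-cancelˡ-≡ 4 _ _ (⊎.inj₁-injective
      (position-injective _≟ᵛ_ (endpoints history) (visited x) (visited y) eq)))
      where
      visited : ∀ x → node (4 + toℕ x) ∈ endpoints history
      visited x = SamePair⇒∈endpoints (Any.map proj₁ (cycleEdge-colored (Fin.toℕ<n x)))

    Next⇒cycleEnd : ∀ {x y : Fin k} → Next x y → cycleEnd (toℕ x) ≡ 4 + toℕ y
    Next⇒cycleEnd {x} {y} next with suc (toℕ x) ℕ.≟ k | next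
    ... | yes _   | inj₂ (_ , y≡0) = cong (4 +_) (sym y≡0)
    ... | yes 1+x≡k | inj₁ y≡1+x   = contradiction (Fin.toℕ<n y) (ℕ.≤⇒≯ (≡⇒≤ (sym (trans y≡1+x 1+x≡k))))
    ... | no _    | inj₁ y≡1+x     = cong (4 +_) (sym y≡1+x)
    ... | no ≢k   | inj₂ (eq , _)  = contradiction eq ≢k

    Next-colored : ∀ {x y} → Next x y → HasColoredEdge G (φ x) (φ y) (k ∸ toℕ x)
    Next-colored {x} {y} next = Any.map⁺ (Any.map⁺ (Any.map
      (map₁ (Sum.map (λ (p , q) → cong f p , cong f q) (λ (p , q) → cong f p , cong f q)))
      (subst (λ n → Any (λ e → SamePair (proj₁ e) (node (4 + toℕ x) , node n) × proj₂ e ≡ k ∸ toℕ x) history)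
        (Next⇒cycleEnd next) (cycleEdge-colored (Fin.toℕ<n x)))))

    Next-functional : ∀ {x x′ y y′ : Fin k} → Next x y → Next x′ y′ → x ≡ x′ → y ≡ y′
    Next-functional p q refl = Fin.toℕ-injective
      (ℕ.+-cancelˡ-≡ 4 _ _ (trans (sym (Next⇒cycleEnd p)) (Next⇒cycleEnd q)))

    HasColoredEdge-sym : ∀ {n} {G : ColoredGraph n} {u v c} → HasColoredEdge G u v c → HasColoredEdge G v u c
    HasColoredEdge-sym = Any.map (map₁ swap)

    -- The edge leaving `x` has color `k ∸ toℕ x`, from which `x` can be recovered.
    same-source : ∀ {x y z w c} → Next x y → Next z w →
                  HasColoredEdge G (φ x) (φ y) c → HasColoredEdge G (φ z) (φ w) c → x ≡ z
    same-source {x} {z = z} xy zw p q = Fin.toℕ-injective (ℕ.∸-cancelˡ-≡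
      (ℕ.<⇒≤ (Fin.toℕ<n x)) (ℕ.<⇒≤ (Fin.toℕ<n z))
      (trans (HasColoredEdge-unique G-FirstFit (Next-colored xy) p)
             (HasColoredEdge-unique G-FirstFit q (Next-colored zw))))

    G-RainbowCopy : RainbowCopy (cycle k 3≤k) G
    G-RainbowCopy = record
      { embedding = mk↣ φ-injective
      ; preserves = λ where
          (inj₁ xy) → HasColoredEdge⇒HasEdge (Next-colored xy)
          (inj₂ yx) → HasColoredEdge⇒HasEdge (HasColoredEdge-sym (Next-colored yx))
      ; rainbow = λ where
          (inj₁ xy) (inj₁ zw) p q →
            let x≡z = same-source xy zw p q in inj₁ (x≡z , Next-functional xy zw x≡z)
          (inj₁ xy) (inj₂ wz) p q →
            let x≡w = same-source xy wz p (HasColoredEdge-sym q) in inj₂ (x≡w , Next-functional xy wz x≡w)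
          (inj₂ yx) (inj₁ zw) p q →
            let y≡z = same-source yx zw (HasColoredEdge-sym p) q in inj₂ (Next-functional yx zw y≡z , y≡z)
          (inj₂ yx) (inj₂ wz) p q →
            let y≡w = same-source yx wz (HasColoredEdge-sym p) (HasColoredEdge-sym q)
            in inj₁ (Next-functional yx wz y≡w , y≡w)
      }

    builderForces-history : BuilderForces (cycle k 3≤k) (length history)
    builderForces-history = _ , G ,
      trans (length-map dress (map (relabel f) history)) (length-map (relabel f) history) ,
      G-FirstFit , G-RainbowCopy

-- Asymptotics

open import Data.Integer.Base using (+_; -[1+_]; +<+)
open import Data.Rational.Base using (ℚ; 0ℚ; 1ℚ; _+_; _*_; _/_; mkℚ; *<*; toℚᵘ; ∣_∣; _<_)

module _ (k : ℕ) (3≤k : 3 ≤ k) where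
  open Construction k 3≤k

  AR-FF-cycle : ∃ (IsAR-FF (cycle k 3≤k))
  AR-FF-cycle = least (builderForces? (cycle k 3≤k) (λ x → next x , inj₁ (next-Next x)))
    (length history) builderForces-history

  module _ {t} (t-least : IsAR-FF (cycle k 3≤k) t) where

    AR-FF-cycle-upper : 8 ℕ.* t ≤ k ℕ.* k ℕ.+ 25 ℕ.* k
    AR-FF-cycle-upper = ℕ.≤-trans (ℕ.*-monoʳ-≤ 8 (proj₂ t-least _ builderForces-history)) length-history

    AR-FF-cycle-lower : k ℕ.* k ≤ 8 ℕ.* t ℕ.+ k
    AR-FF-cycle-lower with proj₁ t-least
    ... | _ , G , refl , ff , copy = rainbow-cycle-size 3≤k ff copy

-- The value at k < 3 is arbitrary.
ar : ℕ → ℕ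
ar k with 3 ℕ.≤? k
... | yes 3≤k = proj₁ (AR-FF-cycle k 3≤k)
... | no  _   = 0

ar-least : ∀ k (3≤k : 3 ≤ k) → IsAR-FF (cycle k 3≤k) (ar k)
ar-least k 3≤k with 3 ℕ.≤? k
-- The cycle depends on the proof of `3 ≤ k`, but all such proofs are equal.
... | yes p = subst (λ q → IsAR-FF (cycle k q) (proj₁ (AR-FF-cycle k p))) (ℕ.≤-irrelevant p 3≤k)
                    (proj₂ (AR-FF-cycle k p))
... | no ≰k = contradiction 3≤k ≰k

deviation : ℕ → ℤ.ℤ
deviation k = (8 ℕ.* ar k) ℤ.⊖ (k ℕ.* k)

deviation-bound : ∀ k → 3 ≤ k → ℤ.∣ deviation k ∣ ≤ 25 ℕ.* k
deviation-bound k 3≤k with ℕ.≤-total (8 ℕ.* ar k) (k ℕ.* k)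
... | inj₁ 8ar≤k² = begin
  ℤ.∣ deviation k ∣             ≡⟨ ℤ.∣⊖∣-≤ 8ar≤k² ⟩
  k ℕ.* k ℕ.∸ 8 ℕ.* ar k        ≤⟨ ℕ.m≤n+o⇒m∸n≤o (k ℕ.* k) (8 ℕ.* ar k) (AR-FF-cycle-lower k 3≤k (ar-least k 3≤k)) ⟩
  k                             ≤⟨ ℕ.m≤n*m k 25 ⟩
  25 ℕ.* k                      ∎
  where open ℕ.≤-Reasoning
... | inj₂ k²≤8ar = begin
  ℤ.∣ deviation k ∣             ≡⟨ ℤ.∣m⊖n∣≡∣n⊖m∣ (8 ℕ.* ar k) (k ℕ.* k) ⟩
  ℤ.∣ (k ℕ.* k) ℤ.⊖ (8 ℕ.* ar k) ∣ ≡⟨ ℤ.∣⊖∣-≤ k²≤8ar ⟩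
  8 ℕ.* ar k ℕ.∸ k ℕ.* k        ≤⟨ ℕ.m≤n+o⇒m∸n≤o (8 ℕ.* ar k) (k ℕ.* k) (AR-FF-cycle-upper k 3≤k (ar-least k 3≤k)) ⟩
  25 ℕ.* k                      ∎
  where open ℕ.≤-Reasoning

-- The equation for the asymptotics solved for its error term, (8 `ar k` - k²)/k²; the value at zero
-- is arbitrary.
relativeError : ℕ → ℚ
relativeError zero      = 0ℚ
relativeError k@(suc _) = deviation k / (k ℕ.* k)

relativeError-tendsToZero : TendsToZero relativeError
relativeError-tendsToZero (mkℚ (+ zero)  _ _) (*<* (+<+ ()))
relativeError-tendsToZero (mkℚ -[1+ _ ] _ _) (*<* ())
-- The error is at most 25/k and ε is at least 1/q. Taking 26 makes the inequality strict and also
-- ensures `3 ≤ k`.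
relativeError-tendsToZero ε@(mkℚ (+ suc p) q-1 _) _ = 26 ℕ.* q , small
  where
  q = suc q-1
  small : ∀ k → 26 ℕ.* q ≤ k → ∣ relativeError k ∣ < ε
  small k@(suc _) 26q≤k = ℚ.toℚᵘ-cancel-< (ℚᵘ.<-respˡ-≃ (ℚᵘ.≃-sym error≃) (*<* (+<+-* ℤ.∣ deviation k ∣ q (suc p) (k ℕ.* k) cross)))
    where
    error≃ : toℚᵘ ∣ relativeError k ∣ ℚᵘ.≃ mkℚᵘ (+ ℤ.∣ deviation k ∣) (ℕ.pred (k ℕ.* k))
    error≃ = ℚᵘ.≃-trans (ℚ.toℚᵘ-homo-∣-∣ (relativeError k))
      (ℚᵘ.∣-∣-cong (ℚ.toℚᵘ-fromℚᵘ (mkℚᵘ (deviation k) (ℕ.pred (k ℕ.* k)))))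
    +<+-* : ∀ a b c d → a ℕ.* b ℕ.< c ℕ.* d → + a ℤ.* + b ℤ.< + c ℤ.* + d
    +<+-* a b c d lt rewrite sym (ℤ.pos-* a b) | sym (ℤ.pos-* c d) = +<+ lt
    cross : ℤ.∣ deviation k ∣ ℕ.* q ℕ.< suc p ℕ.* (k ℕ.* k)
    cross = begin-strict
      ℤ.∣ deviation k ∣ ℕ.* q   ≤⟨ ℕ.*-monoˡ-≤ q (deviation-bound k 3≤k) ⟩
      25 ℕ.* k ℕ.* q            ≡⟨ trans (ℕ.*-assoc 25 k q) (trans (cong (25 ℕ.*_) (ℕ.*-comm k q)) (sym (ℕ.*-assoc 25 q k))) ⟩
      25 ℕ.* q ℕ.* k            <⟨ ℕ.*-monoˡ-< k (ℕ.<-≤-trans (ℕ.*-monoˡ-< q (ℕ.n<1+n 25)) 26q≤k) ⟩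
      k ℕ.* k                   ≤⟨ ℕ.m≤n*m (k ℕ.* k) (suc p) ⟩
      suc p ℕ.* (k ℕ.* k)       ∎
      where
      open ℕ.≤-Reasoning
      3≤k : 3 ≤ k
      3≤k = ℕ.≤-trans (ℕ.≤-trans (s≤s (s≤s (s≤s z≤n))) (ℕ.m≤m*n 26 q)) 26q≤k

-- The asymptotic equation cross-multiplied; the factors 1 are those produced by equality of
-- unnormalised rationals.
deviation-identity : ∀ k → + ar k ℤ.* + (8 ℕ.* (1 ℕ.* (k ℕ.* k))) ≡
  + (k ^ 2) ℤ.* (ℤ.1ℤ ℤ.* + (k ℕ.* k) ℤ.+ deviation k ℤ.* ℤ.1ℤ) ℤ.* ℤ.1ℤ
deviation-identity k = begin
  + ar k ℤ.* + (8 ℕ.* (1 ℕ.* (k ℕ.* k)))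
    ≡⟨ cong (λ n → + ar k ℤ.* + (8 ℕ.* n)) (ℕ.*-identityˡ (k ℕ.* k)) ⟩
  + ar k ℤ.* + (8 ℕ.* (k ℕ.* k))
    ≡⟨ cong (+ ar k ℤ.*_) (ℤ.pos-* 8 (k ℕ.* k)) ⟩
  + ar k ℤ.* (+ 8 ℤ.* + (k ℕ.* k))
    ≡⟨ identity (+ ar k) (+ (k ℕ.* k)) ⟩
  + (k ℕ.* k) ℤ.* (ℤ.1ℤ ℤ.* + (k ℕ.* k) ℤ.+ (+ 8 ℤ.* + ar k ℤ.- + (k ℕ.* k)) ℤ.* ℤ.1ℤ) ℤ.* ℤ.1ℤ
    ≡⟨ cong₂ (λ n d → + n ℤ.* (ℤ.1ℤ ℤ.* + (k ℕ.* k) ℤ.+ d ℤ.* ℤ.1ℤ) ℤ.* ℤ.1ℤ)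
         (cong (k ℕ.*_) (sym (ℕ.*-identityʳ k)))
         (trans (cong (ℤ._- + (k ℕ.* k)) (sym (ℤ.pos-* 8 (ar k)))) (ℤ.m-n≡m⊖n (8 ℕ.* ar k) (k ℕ.* k))) ⟩
  + (k ^ 2) ℤ.* (ℤ.1ℤ ℤ.* + (k ℕ.* k) ℤ.+ deviation k ℤ.* ℤ.1ℤ) ℤ.* ℤ.1ℤ ∎
  where
  open ≡-Reasoning
  identity : ∀ a K → a ℤ.* (+ 8 ℤ.* K) ≡ K ℤ.* (ℤ.1ℤ ℤ.* K ℤ.+ (+ 8 ℤ.* a ℤ.- K) ℤ.* ℤ.1ℤ) ℤ.* ℤ.1ℤ
  identity = ℤ-Solver.solve-∀

ar-asymptotic : ∀ k → 3 ≤ k → (+ ar k) / 1 ≡ ((+ (k ^ 2)) / 8) * (1ℚ + relativeError k)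
ar-asymptotic k@(suc _) _ = ℚ.toℚᵘ-injective (begin-equality
  toℚᵘ ((+ ar k) / 1)
    ≃⟨ ℚ.toℚᵘ-fromℚᵘ (mkℚᵘ (+ ar k) 0) ⟩
  mkℚᵘ (+ ar k) 0
    ≃⟨ *≡* (deviation-identity k) ⟩
  mkℚᵘ (+ (k ^ 2)) 7 ℚᵘ.* (1ℚᵘ ℚᵘ.+ δ)
    ≃⟨ ℚᵘ.*-cong (ℚ.toℚᵘ-fromℚᵘ (mkℚᵘ (+ (k ^ 2)) 7)) (ℚᵘ.+-congʳ 1ℚᵘ (ℚ.toℚᵘ-fromℚᵘ δ)) ⟨
  toℚᵘ ((+ (k ^ 2)) / 8) ℚᵘ.* (1ℚᵘ ℚᵘ.+ toℚᵘ (relativeError k))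
    ≃⟨ ℚᵘ.*-congˡ {toℚᵘ ((+ (k ^ 2)) / 8)} (ℚ.toℚᵘ-homo-+ 1ℚ (relativeError k)) ⟨
  toℚᵘ ((+ (k ^ 2)) / 8) ℚᵘ.* toℚᵘ (1ℚ + relativeError k)
    ≃⟨ ℚ.toℚᵘ-homo-* ((+ (k ^ 2)) / 8) (1ℚ + relativeError k) ⟨
  toℚᵘ (((+ (k ^ 2)) / 8) * (1ℚ + relativeError k)) ∎)
  where
  open ℚᵘ.≤-Reasoning
  δ = mkℚᵘ (deviation k) (ℕ.pred (k ℕ.* k))

theorem14 : Σ (ℕ → ℕ) λ ar →
    (∀ k (3≤k : 3 ≤ k) → IsAR-FF (cycle k 3≤k) (ar k)) ×
    Σ (ℕ → ℚ) λ o →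
    TendsToZero o ×
    (∀ k → 3 ≤ k → (+ ar k) / 1 ≡ ((+ (k ^ 2)) / 8) * (1ℚ + o k))
theorem14 = ar , ar-least , relativeError , relativeError-tendsToZero , ar-asymptotic
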